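{- For every input multiset $D$ of item sizes and every integer $k\geq 1$, $FFk(D_k) \leq \left(1.5+\frac{1}{5k}\right) \cdot OPT(D_k) + 3\cdot k$.
   Context: In the $k$-times bin-packing problem ($k$BP), the input is a multiset $D$ of $n$ positive item sizes, a bin capacity $S>0$, and an integer $k\geq 1$; the goal is to pack the items into the fewest bins so that the sum of item sizes in each bin is at most $S$, each item appears in exactly $k$ different bins, and no bin contains two copies of the same item. $D_k := DD\ldots D$ denotes the sequence consisting of $k$ consecutive copies of $D$ (first all items of instance 1, then all items of instance 2, etc.), and $OPT(D_k)$ is the optimal number of bins for the $k$BP instance. The algorithm $FFk$ (the $k$-times version of First-Fit) processes the items of $D_k$ in this order; each item is placed into the lowest-indexed currently open bin that (a) has enough remaining capacity for it and (b) does not already contain a copy of the same item; if no such bin exists, a new bin is opened for it. $FFk(D_k)$ denotes the number of bins used by $FFk$. -}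

module Defs where

open import Algebra.Structures using (IsAbelianGroup)
open import Data.Fin using (Fin; _≟_)
open import Data.List using (List; []; _∷_; length; filter; foldl; foldr; map; concat; replicate; allFin)
open import Data.List.Membership.DecPropositional using (_∈?_)
open import Data.List.Membership.Propositional using (_∉_)
open import Data.List.Relation.Unary.All using (All)
open import Data.List.Relation.Unary.Unique.Propositional using (Unique)
open import Data.Nat as ℕ using (ℕ)
open import Data.Product using (_×_; ∃-syntax)
import Data.Rational as ℚ
import Data.Rational.Properties as ℚ
open import Data.Vec.Functional using (Vector)
open import Level using (Level; suc; _⊔_; 0ℓ)
open import Relation.Binary.Core using (Rel)
import Relation.Binary.Construct.NonStrictToStrict as Strict
open import Relation.Binary.PropositionalEquality using (_≡_)
open import Relation.Binary.Structures using (IsDecTotalOrder)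
open import Relation.Nullary.Decidable using (Dec; yes; no; ¬?; _×-dec_)

-- First-Fit only adds and compares sizes, so sizes may come from any abelian
-- group with a decidable, translation-invariant total order: ℤ, ℚ and,
-- classically, ℝ.
record OrderedAbelianGroup c ℓ₁ ℓ₂ : Set (suc (c ⊔ ℓ₁ ⊔ ℓ₂)) where
  infix  4 _≈_ _≤_ _<_
  infixl 6 _+_
  field
    Carrier         : Set c
    _≈_             : Rel Carrier ℓ₁
    _≤_             : Rel Carrier ℓ₂
    _+_             : Carrier → Carrier → Carrier
    0#              : Carrier
    -_              : Carrier → Carrier
    isAbelianGroup  : IsAbelianGroup _≈_ _+_ 0# -_
    isDecTotalOrder : IsDecTotalOrder _≈_ _≤_
    +-monoʳ-≤       : ∀ x {y z} → y ≤ z → x + y ≤ x + z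

  _<_ : Rel Carrier (ℓ₁ ⊔ ℓ₂)
  _<_ = Strict._<_ _≈_ _≤_

  open IsDecTotalOrder isDecTotalOrder public using (_≤?_)

ℚ-orderedAbelianGroup : OrderedAbelianGroup 0ℓ 0ℓ 0ℓ
ℚ-orderedAbelianGroup = record
  { isAbelianGroup  = ℚ.+-0-isAbelianGroup
  ; isDecTotalOrder = ℚ.≤-isDecTotalOrder
  ; +-monoʳ-≤       = ℚ.+-monoʳ-≤
  }

-- The multiset D is an indexed family: items are indices, so "copies of the
-- same item" are equal indices, and distinct items may have equal sizes.
module BinPacking {c ℓ₁ ℓ₂ : Level} (G : OrderedAbelianGroup c ℓ₁ ℓ₂)
                  {n : ℕ} (D : Vector (OrderedAbelianGroup.Carrier G) n)
                  (S : OrderedAbelianGroup.Carrier G) where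

  open OrderedAbelianGroup G

  Item : Set
  Item = Fin n

  Bin : Set
  Bin = List Item

  load : Bin → Carrier
  load b = foldr _+_ 0# (map D b)

  multiplicity : Item → List Bin → ℕ
  multiplicity i bs = length (filter (λ b → _∈?_ _≟_ i b) bs)

  record IsPacking (k : ℕ) (bs : List Bin) : Set ℓ₂ where
    field
      withinCapacity : All (λ b → load b ≤ S) bs
      noDuplicates   : All Unique bs
      k-times        : ∀ i → multiplicity i bs ≡ k

  -- No optimum exists if some item is larger than S (and k ≥ 1).
  IsOPT : ℕ → ℕ → Set ℓ₂
  IsOPT k m = (∃[ bs ] IsPacking k bs × length bs ≡ m)
            × (∀ bs → IsPacking k bs → m ℕ.≤ length bs)

  Fits : Item → Bin → Set ℓ₂
  Fits i b = (D i + load b ≤ S) × (i ∉ b)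

  fits? : ∀ i b → Dec (Fits i b)
  fits? i b = (D i + load b ≤? S) ×-dec ¬? (_∈?_ _≟_ i b)

  -- Open bins are listed in order of increasing index.
  place : List Bin → Item → List Bin
  place []       i = (i ∷ []) ∷ []
  place (b ∷ bs) i with fits? i b
  ... | yes _ = (i ∷ b) ∷ bs
  ... | no  _ = b ∷ place bs i

  copies : ℕ → List Item
  copies k = concat (replicate k (allFin n))

  FFk : ℕ → ℕ
  FFk k = length (foldl place [] (copies k))

{-# OPTIONS --safe #-}
module Submission where

-- Call the bins opened during the j-th instance class j.  Since the copies
-- within one instance are distinct, class j is an ordinary First-Fit packing of
-- the items that all earlier classes reject.  As in the classical analysis of
-- First-Fit, weigh an item of size a (with S = 1) by 1.2 a plus a bonus: 0 up to
-- 1/6, 0.6 a − 0.1 up to 1/3, 0.1 up to 1/2, and items a > 1/2 (large) weigh 1.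
-- All but three bins of a class then have amortised weight at least 1, but a
-- bin of the optimal packing may weigh 1.7.  Two effects reduce this to 1.5
-- for almost every instance.
--
-- If the next instance fills every bin of class j with a large item to at
-- least 2/3 (class j is "filled"), a large item of size a needs only the
-- weight 1 − φ with φ = max (0, 0.8 − 1.2 a), because the remaining weight is
-- contributed by the items put on top of it.  If some such bin stays below
-- 2/3, the next instance opens bins only for items above 1/3, up to copies of
-- the few items in that bin: class j + 1 is "light", and there an item of size
-- in (1/3 , 1/2] may weigh 1/2 and a smaller one nothing.
--
-- In all four cases an optimal bin whose large item has excess φ weighs at most
-- 1.5 + φ [class j not filled] − φ [class j light].  Class j + 1 is light exactly
-- if class j is not filled, so the excesses telescope and, φ being at most 0.2,
-- the k instances together weigh at most 1.5 k + 0.2 per optimal bin.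

open import Defs
open import Algebra.Bundles using (AbelianGroup)
open import Data.Bool using (Bool; true; false; not)
open import Data.Empty using (⊥-elim)
open import Data.Fin using (Fin; zero; suc; _≟_)
open import Data.Integer as ℤ using (+_)
import Data.Integer.Properties as ℤ
open import Data.List using (List; []; _∷_; _++_; length; map; foldr; foldl; filter; allFin)
open import Data.List.Membership.DecPropositional using (_∈?_)
open import Data.List.Membership.Propositional using (_∈_; _∉_; find; lose)
open import Data.List.Membership.Propositional.Properties using (∈-++⁺ʳ; ∈-filter⁻)
open import Data.List.Properties using (filter-accept; filter-reject; foldl-++; ++-identityʳ; ++-assoc)
open import Data.List.Relation.Binary.Pointwise as Pointwise using (Pointwise; []; _∷_)
open import Data.List.Relation.Binary.Subset.Propositional using (_⊆_)
open import Data.List.Relation.Unary.All as All using (All; []; _∷_; all?)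
open import Data.List.Relation.Unary.All.Properties as All using (¬All⇒Any¬; ¬Any⇒All¬; all-filter)
open import Data.List.Relation.Unary.AllPairs using (AllPairs; []; _∷_)
import Data.List.Relation.Unary.AllPairs.Properties as AllPairs
open import Data.List.Relation.Unary.Any using (Any; here; there; any?)
open import Data.List.Relation.Unary.Unique.Propositional using (Unique)
import Data.List.Relation.Unary.Unique.Propositional.Properties as Unique
open import Data.Nat as ℕ using (ℕ; zero; suc; NonZero)
open import Data.Nat.Properties as ℕ using (m*n≢0)
import Data.Nat.Tactic.RingSolver as ℕ-Solver
open import Data.Product using (_×_; _,_; proj₁; proj₂; ∃-syntax; ∃₂)
import Data.Rational as ℚ
import Data.Rational.Properties as ℚ
open import Data.Rational.Unnormalised as ℚᵘ using (mkℚᵘ; *≤*)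
import Data.Rational.Unnormalised.Properties as ℚᵘ
open import Data.Sum using (_⊎_; inj₁; inj₂)
open import Data.Vec as Vec using (Vec; []; _∷_; lookup; zipWith)
open import Data.Vec.Functional using (Vector)
open import Function using (_∘_)
open import Level using (Level; _⊔_)
open import Relation.Binary.PropositionalEquality as ≡ using (_≡_; _≢_)
open import Relation.Binary.Structures using (IsDecTotalOrder)
open import Relation.Nullary using (¬_; Dec; yes; no; ¬?)
open import Relation.Nullary.Decidable using (decidable-stable; _→-dec_)

-- Linear arithmetic over an ordered abelian group

module LinearArithmetic {c ℓ₁ ℓ₂ : Level} (G : OrderedAbelianGroup c ℓ₁ ℓ₂) where

  open OrderedAbelianGroup G

  abelianGroup : AbelianGroup c ℓ₁
  abelianGroup = record { isAbelianGroup = isAbelianGroup }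

  open AbelianGroup abelianGroup public
    using (commutativeMonoid; setoid)
    renaming ( comm to +-comm; assoc to +-assoc; ∙-cong to +-cong
             ; identityˡ to +-identityˡ; identityʳ to +-identityʳ
             ; inverseˡ to -‿inverseˡ; inverseʳ to -‿inverseʳ
             ; refl to ≈-refl; sym to ≈-sym; trans to ≈-trans )
  open IsDecTotalOrder isDecTotalOrder public
    using (total) renaming (refl to ≤-refl; trans to ≤-trans; reflexive to ≤-reflexive)
  open import Algebra.Properties.CommutativeMonoid.Mult commutativeMonoid public
    using (×-congʳ; ×-homo-+; ×-assocˡ; ×-distrib-+) renaming (_×_ to infixr 8 _·_)
  open import Algebra.Properties.CommutativeSemigroup
    (AbelianGroup.commutativeSemigroup abelianGroup) public
    using (interchange; x∙yz≈y∙xz)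
  open import Relation.Binary.Reasoning.Setoid setoid

  +-mono-≤ : ∀ {a b x y} → a ≤ b → x ≤ y → a + x ≤ b + y
  +-mono-≤ {a} {b} {x} {y} a≤b x≤y =
    ≤-trans (+-monoʳ-≤ a x≤y)
      (≤-trans (≤-reflexive (+-comm a y))
        (≤-trans (+-monoʳ-≤ y a≤b) (≤-reflexive (+-comm y b))))

  ·-monoʳ-≤ : ∀ n {x y} → x ≤ y → n · x ≤ n · y
  ·-monoʳ-≤ zero    x≤y = ≤-refl
  ·-monoʳ-≤ (suc n) x≤y = +-mono-≤ x≤y (·-monoʳ-≤ n x≤y)

  ·-zeroʳ : ∀ n → n · 0# ≈ 0#
  ·-zeroʳ zero    = ≈-refl
  ·-zeroʳ (suc n) = ≈-trans (+-identityˡ _) (·-zeroʳ n)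

  ≰⇒≥ : ∀ {x y} → ¬ x ≤ y → y ≤ x
  ≰⇒≥ {x} {y} x≰y with total x y
  ... | inj₁ x≤y = ⊥-elim (x≰y x≤y)
  ... | inj₂ y≤x = y≤x

  +-cancelˡ-≤ : ∀ x {a b} → x + a ≤ x + b → a ≤ b
  +-cancelˡ-≤ x {a} {b} p =
    ≤-trans (≤-reflexive (≈-sym (shift a))) (≤-trans (+-monoʳ-≤ (- x) p) (≤-reflexive (shift b)))
    where
    shift : ∀ a → - x + (x + a) ≈ a
    shift a = begin
      - x + (x + a)  ≈⟨ +-assoc (- x) x a ⟨
      - x + x + a    ≈⟨ +-cong (-‿inverseˡ x) ≈-refl ⟩
      0# + a         ≈⟨ +-identityˡ a ⟩
      a              ∎

  -- If `y ≤ x` instead, then `n · y ≤ n · x`, so `n` copies cancel and one remains on each side.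
  ·-cancelˡ-≤ : ∀ n {x y} → suc n · x ≤ suc n · y → x ≤ y
  ·-cancelˡ-≤ n {x} {y} p with total x y
  ... | inj₁ x≤y = x≤y
  ... | inj₂ y≤x = +-cancelˡ-≤ (n · x)
    (≤-trans (≤-reflexive (+-comm (n · x) x))
      (≤-trans p (≤-trans (+-monoʳ-≤ y (·-monoʳ-≤ n y≤x)) (≤-reflexive (+-comm y (n · x))))))

  -- Reflection of linear inequalities

  infixl 6 _⊕_
  infixr 8 _⊛_

  -- Coefficients are natural numbers, so that the side condition of `linear` is closed by `≡.refl`.
  -- An inverse enters as a variable of its own, tied to its original by `0≤x-x` or `x-x≤0` where
  -- necessary.
  data Expr (m : ℕ) : Set where
    var : Fin m → Expr m
    ∅   : Expr m
    _⊕_ : Expr m → Expr m → Expr m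
    _⊛_ : ℕ → Expr m → Expr m

  pattern x₀ = var zero
  pattern x₁ = var (suc zero)
  pattern x₂ = var (suc (suc zero))
  pattern x₃ = var (suc (suc (suc zero)))
  pattern x₄ = var (suc (suc (suc (suc zero))))
  pattern x₅ = var (suc (suc (suc (suc (suc zero)))))
  pattern x₆ = var (suc (suc (suc (suc (suc (suc zero))))))
  pattern x₇ = var (suc (suc (suc (suc (suc (suc (suc zero)))))))
  pattern x₈ = var (suc (suc (suc (suc (suc (suc (suc (suc zero))))))))
  pattern x₉ = var (suc (suc (suc (suc (suc (suc (suc (suc (suc zero)))))))))

  ⟦_⟧ : ∀ {m} → Expr m → Vec Carrier m → Carrier
  ⟦ var i ⟧ ρ = lookup ρ i
  ⟦ ∅ ⟧     ρ = 0#
  ⟦ e ⊕ d ⟧ ρ = ⟦ e ⟧ ρ + ⟦ d ⟧ ρ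
  ⟦ n ⊛ e ⟧ ρ = n · ⟦ e ⟧ ρ

  unit : ∀ {m} → Fin m → Vec ℕ m
  unit zero    = 1 ∷ Vec.replicate _ 0
  unit (suc i) = 0 ∷ unit i

  coefficients : ∀ {m} → Expr m → Vec ℕ m
  coefficients (var i) = unit i
  coefficients ∅       = Vec.replicate _ 0
  coefficients (e ⊕ d) = zipWith ℕ._+_ (coefficients e) (coefficients d)
  coefficients (n ⊛ e) = Vec.map (n ℕ.*_) (coefficients e)

  combination : ∀ {m} → Vec ℕ m → Vec Carrier m → Carrier
  combination []       []      = 0#
  combination (k ∷ ks) (x ∷ ρ) = k · x + combination ks ρ

  combination-zero : ∀ {m} (ρ : Vec Carrier m) → combination (Vec.replicate m 0) ρ ≈ 0#
  combination-zero []      = ≈-refl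
  combination-zero (x ∷ ρ) = ≈-trans (+-identityˡ _) (combination-zero ρ)

  combination-unit : ∀ {m} (i : Fin m) ρ → combination (unit i) ρ ≈ lookup ρ i
  combination-unit zero    (x ∷ ρ) = begin
    x + 0# + combination (Vec.replicate _ 0) ρ  ≈⟨ +-cong (+-identityʳ x) (combination-zero ρ) ⟩
    x + 0#                                  ≈⟨ +-identityʳ x ⟩
    x                                       ∎
  combination-unit (suc i) (x ∷ ρ) = ≈-trans (+-identityˡ _) (combination-unit i ρ)

  combination-+ : ∀ {m} (ks ls : Vec ℕ m) ρ →
                  combination (zipWith ℕ._+_ ks ls) ρ ≈ combination ks ρ + combination ls ρ
  combination-+ []       []       []      = ≈-sym (+-identityˡ 0#)
  combination-+ (k ∷ ks) (l ∷ ls) (x ∷ ρ) =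
    ≈-trans (+-cong (×-homo-+ x k l) (combination-+ ks ls ρ)) (interchange _ _ _ _)

  combination-* : ∀ {m} n (ks : Vec ℕ m) ρ →
                  combination (Vec.map (n ℕ.*_) ks) ρ ≈ n · combination ks ρ
  combination-* n []       []      = ≈-sym (·-zeroʳ n)
  combination-* n (k ∷ ks) (x ∷ ρ) =
    ≈-trans (+-cong (≈-sym (×-assocˡ x n k)) (combination-* n ks ρ)) (≈-sym (×-distrib-+ _ _ n))

  ⟦⟧≈combination : ∀ {m} (e : Expr m) ρ → ⟦ e ⟧ ρ ≈ combination (coefficients e) ρ
  ⟦⟧≈combination (var i) ρ = ≈-sym (combination-unit i ρ)
  ⟦⟧≈combination ∅       ρ = ≈-sym (combination-zero ρ)
  ⟦⟧≈combination (e ⊕ d) ρ =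
    ≈-trans (+-cong (⟦⟧≈combination e ρ) (⟦⟧≈combination d ρ))
      (≈-sym (combination-+ (coefficients e) (coefficients d) ρ))
  ⟦⟧≈combination (n ⊛ e) ρ =
    ≈-trans (×-congʳ n (⟦⟧≈combination e ρ)) (≈-sym (combination-* n (coefficients e) ρ))

  infixl 2 _⊞_
  infixr 3 _⊠_
  infix  4 ⟨_≲_⟩_

  data Derivation {m} (ρ : Vec Carrier m) : Set ℓ₂ where
    ⟨_≲_⟩_ : ∀ l r → ⟦ l ⟧ ρ ≤ ⟦ r ⟧ ρ → Derivation ρ
    _⊞_    : Derivation ρ → Derivation ρ → Derivation ρ
    _⊠_    : ℕ → Derivation ρ → Derivation ρ

  lower upper : ∀ {m} {ρ : Vec Carrier m} → Derivation ρ → Expr m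
  lower (⟨ l ≲ r ⟩ _) = l
  lower (d ⊞ e)       = lower d ⊕ lower e
  lower (n ⊠ d)       = n ⊛ lower d
  upper (⟨ l ≲ r ⟩ _) = r
  upper (d ⊞ e)       = upper d ⊕ upper e
  upper (n ⊠ d)       = n ⊛ upper d

  lower≤upper : ∀ {m} {ρ : Vec Carrier m} (d : Derivation ρ) → ⟦ lower d ⟧ ρ ≤ ⟦ upper d ⟧ ρ
  lower≤upper (⟨ l ≲ r ⟩ p) = p
  lower≤upper (d ⊞ e)       = +-mono-≤ (lower≤upper d) (lower≤upper e)
  lower≤upper (n ⊠ d)       = ·-monoʳ-≤ n (lower≤upper d)

  -- Farkas certificates: l ≤ r follows if the derivation's inequality is a
  -- positive multiple of it up to terms common to both sides.
  linear : ∀ {m} (ρ : Vec Carrier m) (l r : Expr m) (n : ℕ) (d : Derivation ρ) →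
           coefficients (lower d ⊕ suc n ⊛ r) ≡ coefficients (upper d ⊕ suc n ⊛ l) →
           ⟦ l ⟧ ρ ≤ ⟦ r ⟧ ρ
  linear ρ l r n d eq = ·-cancelˡ-≤ n (+-cancelˡ-≤ (⟦ lower d ⟧ ρ)
    (≤-trans (+-mono-≤ (lower≤upper d) ≤-refl) (≤-reflexive same)))
    where
    same : ⟦ upper d ⊕ suc n ⊛ l ⟧ ρ ≈ ⟦ lower d ⊕ suc n ⊛ r ⟧ ρ
    same = begin
      ⟦ upper d ⊕ suc n ⊛ l ⟧ ρ                          ≈⟨ ⟦⟧≈combination (upper d ⊕ suc n ⊛ l) ρ ⟩
      combination (coefficients (upper d ⊕ suc n ⊛ l)) ρ  ≡⟨ ≡.cong (λ ks → combination ks ρ) eq ⟨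
      combination (coefficients (lower d ⊕ suc n ⊛ r)) ρ  ≈⟨ ⟦⟧≈combination (lower d ⊕ suc n ⊛ r) ρ ⟨
      ⟦ lower d ⊕ suc n ⊛ r ⟧ ρ                          ∎

-- Sums over lists

module Sums {c ℓ₁ ℓ₂ : Level} (G : OrderedAbelianGroup c ℓ₁ ℓ₂) where

  open OrderedAbelianGroup G
  open LinearArithmetic G

  module _ {a : Level} {A : Set a} where

    ∑ : (A → Carrier) → List A → Carrier
    ∑ g xs = foldr _+_ 0# (map g xs)

    ∑-mono-All : ∀ {g h} {xs} → All (λ x → g x ≤ h x) xs → ∑ g xs ≤ ∑ h xs
    ∑-mono-All []       = ≤-refl
    ∑-mono-All (p ∷ ps) = +-mono-≤ p (∑-mono-All ps)

    ∑-mono : ∀ {g h} → (∀ x → g x ≤ h x) → ∀ xs → ∑ g xs ≤ ∑ h xs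
    ∑-mono p xs = ∑-mono-All (All.universal p xs)

    ∑-nonneg : ∀ {g} → (∀ x → 0# ≤ g x) → ∀ xs → 0# ≤ ∑ g xs
    ∑-nonneg p []       = ≤-refl
    ∑-nonneg {g} p (x ∷ xs) = linear (g x ∷ ∑ g xs ∷ []) ∅ (x₀ ⊕ x₁) 0
      (⟨ ∅ ≲ x₀ ⟩ p x ⊞ ⟨ ∅ ≲ x₁ ⟩ ∑-nonneg p xs) ≡.refl

    ∑-+ : ∀ g h xs → ∑ (λ x → g x + h x) xs ≈ ∑ g xs + ∑ h xs
    ∑-+ g h []       = ≈-sym (+-identityˡ 0#)
    ∑-+ g h (x ∷ xs) = ≈-trans (+-cong ≈-refl (∑-+ g h xs)) (interchange _ _ _ _)

    ∑-++ : ∀ g xs ys → ∑ g (xs ++ ys) ≈ ∑ g xs + ∑ g ys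
    ∑-++ g []       ys = ≈-sym (+-identityˡ _)
    ∑-++ g (x ∷ xs) ys = ≈-trans (+-cong ≈-refl (∑-++ g xs ys)) (≈-sym (+-assoc _ _ _))

    ∑-const : ∀ k xs → ∑ (λ (_ : A) → k) xs ≈ length xs · k
    ∑-const k []       = ≈-refl
    ∑-const k (x ∷ xs) = +-cong ≈-refl (∑-const k xs)

    ∑-0 : ∀ {g} {xs} → All (λ x → g x ≈ 0#) xs → ∑ g xs ≈ 0#
    ∑-0 []       = ≈-refl
    ∑-0 (p ∷ ps) = ≈-trans (+-cong p (∑-0 ps)) (+-identityˡ 0#)

    ∑-· : ∀ n g xs → ∑ (λ x → n · g x) xs ≈ n · ∑ g xs
    ∑-· n g []       = ≈-sym (·-zeroʳ n)
    ∑-· n g (x ∷ xs) = ≈-trans (+-cong ≈-refl (∑-· n g xs)) (≈-sym (×-distrib-+ _ _ n))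

    -- One `ys` serves every `g`, so load, weight and excess of a bin can be split at the same item.
    -- Further occurrences of `x` may stay in `ys`; only the other elements are tracked.
    ∑-extract : ∀ {x xs} → x ∈ xs →
                ∃[ ys ] (∀ g → ∑ g xs ≈ g x + ∑ g ys) × (∀ {z} → z ∈ xs → z ≢ x → z ∈ ys)
    ∑-extract {xs = y ∷ xs} (here ≡.refl) = xs , (λ g → ≈-refl) , λ where
      (here z≡x)   z≢x → ⊥-elim (z≢x z≡x)
      (there z∈xs) z≢x → z∈xs
    ∑-extract {x} {y ∷ xs} (there x∈xs) with ∑-extract x∈xs
    ... | ys , eq , others = y ∷ ys , (λ g → ≈-trans (+-cong ≈-refl (eq g)) (x∙yz≈y∙xz (g y) (g x) _)) , λ where
      (here z≡y)   z≢x → here z≡y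
      (there z∈xs) z≢x → there (others z∈xs z≢x)

    -- Each element of `xs` is cancelled against its own occurrence in `ys`; by uniqueness the later
    -- elements survive the removal.
    ∑-⊆ : ∀ {g} → (∀ x → 0# ≤ g x) → ∀ {xs ys} → Unique xs → xs ⊆ ys → ∑ g xs ≤ ∑ g ys
    ∑-⊆ g≥0 {[]}     {ys} []         xs⊆ys = ∑-nonneg g≥0 ys
    ∑-⊆ {g} g≥0 {x ∷ xs} (x∉xs ∷ u) xs⊆ys with ∑-extract (xs⊆ys (here ≡.refl))
    ... | zs , eq , others = ≤-trans
      (+-monoʳ-≤ (g x) (∑-⊆ g≥0 u λ z∈xs → others (xs⊆ys (there z∈xs)) (All.lookup x∉xs z∈xs ∘ ≡.sym)))
      (≤-reflexive (≈-sym (eq g)))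

    ∈⇒≤∑ : ∀ {g} → (∀ x → 0# ≤ g x) → ∀ {x xs} → x ∈ xs → g x ≤ ∑ g xs
    ∈⇒≤∑ {g} g≥0 {x} {xs} x∈xs with ∑-extract x∈xs
    ... | ys , eq , _ = linear (g x ∷ ∑ g ys ∷ ∑ g xs ∷ []) x₀ x₂ 0
      (⟨ x₀ ⊕ x₁ ≲ x₂ ⟩ ≤-reflexive (≈-sym (eq g)) ⊞ ⟨ ∅ ≲ x₁ ⟩ ∑-nonneg g≥0 ys) ≡.refl

-- Weights

module Weights {c ℓ₁ ℓ₂ : Level} (G : OrderedAbelianGroup c ℓ₁ ℓ₂)
               (S : OrderedAbelianGroup.Carrier G)
               (0≤S : OrderedAbelianGroup._≤_ G (OrderedAbelianGroup.0# G) S) where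

  open OrderedAbelianGroup G
  open LinearArithmetic G

  -- With `S` = 1 the thresholds are 1/6, 1/3, 1/2 and 2/3; the excess vanishes at the last. Weights
  -- are defined on this evidence, so that every bound is a case analysis with the inequalities at
  -- hand.
  data Size (a : Carrier) : Set ℓ₂ where
    tiny   : 2 · a ≤ S → 3 · a ≤ S → 6 · a ≤ S → Size a
    small  : 2 · a ≤ S → ¬ 6 · a ≤ S → 3 · a ≤ S → Size a
    medium : ¬ 3 · a ≤ S → 2 · a ≤ S → Size a
    large  : ¬ 2 · a ≤ S → ¬ 2 · S ≤ 3 · a → Size a
    huge   : ¬ 2 · a ≤ S → 2 · S ≤ 3 · a → Size a

  size : ∀ a → Size a
  size a with 2 · a ≤? S | 3 · a ≤? S | 6 · a ≤? S | 2 · S ≤? 3 · a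
  ... | yes p | yes q | yes r | _     = tiny p q r
  ... | yes p | yes q | no  r | _     = small p r q
  ... | yes p | no  q | _     | _     = medium q p
  ... | no  p | _     | _     | no  q = large p q
  ... | no  p | _     | _     | yes q = huge p q

  -- All weights are in tenths, so that 10 · S stands for the weight 1.  The 1.2 a
  -- part of a weight is fill, and φ is excess; top is the weight of a large item,
  -- half that of any other item in a light class.
  fill bonus excess half : ∀ {a} → Size a → Carrier

  fill {a} (tiny _ _ _)     = 12 · a
  fill {a} (small _ _ _)  = 12 · a
  fill {a} (medium _ _) = 12 · a
  fill     (large _ _)  = 0#
  fill     (huge _ _)   = 0#

  bonus     (tiny _ _ _)     = 0#
  bonus {a} (small _ _ _)  = 6 · a + - S
  bonus     (medium _ _) = S
  bonus     (large _ _)  = 0#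
  bonus     (huge _ _)   = 0#

  half (tiny _ _ _)     = 0#
  half (small _ _ _)  = 0#
  half (medium _ _) = 5 · S
  half (large _ _)  = 0#
  half (huge _ _)   = 0#

  excess     (tiny _ _ _)     = 0#
  excess     (small _ _ _)  = 0#
  excess     (medium _ _) = 0#
  excess {a} (large _ _)  = 4 · (2 · S + - (3 · a))
  excess     (huge _ _)   = 0#

  top : ∀ {a} → Bool → Size a → Carrier
  top     filled (tiny _ _ _)     = 0#
  top     filled (small _ _ _)  = 0#
  top     filled (medium _ _) = 0#
  -- This is `10 · S` minus the excess `8 · S - 12 · a`.
  top {a} true   (large _ _)  = 2 · S + 12 · a
  top     false  (large _ _)  = 10 · S
  top     filled (huge _ _)   = 10 · S

  rest : ∀ {a} → Bool → Size a → Carrier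
  rest false s = fill s + bonus s
  rest true  s = half s

  weight : ∀ {a} → Bool → Bool → Size a → Carrier
  weight light filled s = top filled s + rest light s

  x-x≤0 : ∀ x → x + - x ≤ 0#
  x-x≤0 x = ≤-reflexive (-‿inverseʳ x)

  0≤x-x : ∀ x → 0# ≤ x + - x
  0≤x-x x = ≤-reflexive (≈-sym (-‿inverseʳ x))

  module _ {a} (0≤a : 0# ≤ a) where

    0≤n·a : ∀ n → 0# ≤ n · a
    0≤n·a n = ≤-trans (≤-reflexive (≈-sym (·-zeroʳ n))) (·-monoʳ-≤ n 0≤a)

    fill≥0 : (s : Size a) → 0# ≤ fill s
    fill≥0 (tiny _ _ _)     = 0≤n·a 12
    fill≥0 (small _ _ _)  = 0≤n·a 12
    fill≥0 (medium _ _) = 0≤n·a 12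
    fill≥0 (large _ _)  = ≤-refl
    fill≥0 (huge _ _)   = ≤-refl

  bonus≥0 : ∀ {a} (s : Size a) → 0# ≤ bonus s
  bonus≥0     (tiny _ _ _)     = ≤-refl
  bonus≥0 {a} (small _ p _)  = linear (a ∷ S ∷ - S ∷ []) ∅ (6 ⊛ x₀ ⊕ x₂) 0
    (⟨ x₁ ≲ 6 ⊛ x₀ ⟩ ≰⇒≥ p ⊞ ⟨ ∅ ≲ x₁ ⊕ x₂ ⟩ 0≤x-x S) ≡.refl
  bonus≥0     (medium _ _) = 0≤S
  bonus≥0     (large _ _)  = ≤-refl
  bonus≥0     (huge _ _)   = ≤-refl

  half≥0 : ∀ {a} (s : Size a) → 0# ≤ half s
  half≥0 (tiny _ _ _)     = ≤-refl
  half≥0 (small _ _ _)  = ≤-refl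
  half≥0 (medium _ _) = 0≤n·a 0≤S 5
  half≥0 (large _ _)  = ≤-refl
  half≥0 (huge _ _)   = ≤-refl

  excess≥0 : ∀ {a} (s : Size a) → 0# ≤ excess s
  excess≥0     (tiny _ _ _)     = ≤-refl
  excess≥0     (small _ _ _)  = ≤-refl
  excess≥0     (medium _ _) = ≤-refl
  excess≥0 {a} (large _ q)  = linear (a ∷ S ∷ - (3 · a) ∷ []) ∅ (4 ⊛ (2 ⊛ x₁ ⊕ x₂)) 0
    (4 ⊠ ⟨ 3 ⊛ x₀ ≲ 2 ⊛ x₁ ⟩ ≰⇒≥ q ⊞ 4 ⊠ ⟨ ∅ ≲ 3 ⊛ x₀ ⊕ x₂ ⟩ 0≤x-x (3 · a)) ≡.refl
  excess≥0     (huge _ _)   = ≤-refl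

  top≥0 : ∀ {a} → 0# ≤ a → ∀ filled (s : Size a) → 0# ≤ top filled s
  top≥0     0≤a filled (tiny _ _ _)     = ≤-refl
  top≥0     0≤a filled (small _ _ _)  = ≤-refl
  top≥0     0≤a filled (medium _ _) = ≤-refl
  top≥0 {a} 0≤a true   (large _ _)  = linear (a ∷ S ∷ []) ∅ (2 ⊛ x₁ ⊕ 12 ⊛ x₀) 0
    (2 ⊠ ⟨ ∅ ≲ x₁ ⟩ 0≤S ⊞ 12 ⊠ ⟨ ∅ ≲ x₀ ⟩ 0≤a) ≡.refl
  top≥0     0≤a false  (large _ _)  = 0≤n·a 0≤S 10
  top≥0     0≤a filled (huge _ _)   = 0≤n·a 0≤S 10

  +-nonneg : ∀ {x y} → 0# ≤ x → 0# ≤ y → 0# ≤ x + y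
  +-nonneg 0≤x 0≤y = ≤-trans (≤-reflexive (≈-sym (+-identityˡ 0#))) (+-mono-≤ 0≤x 0≤y)

  x≤x+y : ∀ {x y} → 0# ≤ y → x ≤ x + y
  x≤x+y {x} 0≤y = ≤-trans (≤-reflexive (≈-sym (+-identityʳ x))) (+-monoʳ-≤ x 0≤y)

  x≤y+x : ∀ {x y} → 0# ≤ y → x ≤ y + x
  x≤y+x {x} {y} 0≤y = ≤-trans (x≤x+y 0≤y) (≤-reflexive (+-comm x y))

  rest≥0 : ∀ {a} → 0# ≤ a → ∀ light (s : Size a) → 0# ≤ rest light s
  rest≥0 0≤a false s = +-nonneg (fill≥0 0≤a s) (bonus≥0 s)
  rest≥0 0≤a true  s = half≥0 s

  weight≥0 : ∀ {a} → 0# ≤ a → ∀ light filled (s : Size a) → 0# ≤ weight light filled s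
  weight≥0 0≤a light filled s = +-nonneg (top≥0 0≤a filled s) (rest≥0 0≤a light s)

  fill≤weight : ∀ {a} → 0# ≤ a → ∀ filled (s : Size a) → fill s ≤ weight false filled s
  fill≤weight 0≤a filled s = ≤-trans (x≤x+y (bonus≥0 s)) (x≤y+x (top≥0 0≤a filled s))

  module _ {a} (2a≤S : 2 · a ≤ S) where

    top≈0 : ∀ filled (s : Size a) → top filled s ≈ 0#
    top≈0 filled (tiny _ _ _)     = ≈-refl
    top≈0 filled (small _ _ _)  = ≈-refl
    top≈0 filled (medium _ _) = ≈-refl
    top≈0 filled (large p _)  = ⊥-elim (p 2a≤S)
    top≈0 filled (huge p _)   = ⊥-elim (p 2a≤S)

    excess≈0 : (s : Size a) → excess s ≈ 0#
    excess≈0 (tiny _ _ _)     = ≈-refl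
    excess≈0 (small _ _ _)  = ≈-refl
    excess≈0 (medium _ _) = ≈-refl
    excess≈0 (large p _)  = ⊥-elim (p 2a≤S)
    excess≈0 (huge p _)   = ⊥-elim (p 2a≤S)

    fill≈12a : (s : Size a) → fill s ≈ 12 · a
    fill≈12a (tiny _ _ _)     = ≈-refl
    fill≈12a (small _ _ _)  = ≈-refl
    fill≈12a (medium _ _) = ≈-refl
    fill≈12a (large p _)  = ⊥-elim (p 2a≤S)
    fill≈12a (huge p _)   = ⊥-elim (p 2a≤S)

  fill≤12a : ∀ {a} → 0# ≤ a → (s : Size a) → fill s ≤ 12 · a
  fill≤12a 0≤a (tiny _ _ _)     = ≤-refl
  fill≤12a 0≤a (small _ _ _)  = ≤-refl
  fill≤12a 0≤a (medium _ _) = ≤-refl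
  fill≤12a 0≤a (large _ _)  = 0≤n·a 0≤a 12
  fill≤12a 0≤a (huge _ _)   = 0≤n·a 0≤a 12

  bonus≤3a : ∀ {a} → 0# ≤ a → (s : Size a) → bonus s ≤ 3 · a
  bonus≤3a     0≤a (tiny _ _ _)     = 0≤n·a 0≤a 3
  bonus≤3a {a} 0≤a (small _ _ q)  = linear (a ∷ S ∷ - S ∷ []) (6 ⊛ x₀ ⊕ x₂) (3 ⊛ x₀) 0
    (⟨ 3 ⊛ x₀ ≲ x₁ ⟩ q ⊞ ⟨ x₁ ⊕ x₂ ≲ ∅ ⟩ x-x≤0 S) ≡.refl
  bonus≤3a     0≤a (medium p _) = ≰⇒≥ p
  bonus≤3a     0≤a (large _ _)  = 0≤n·a 0≤a 3
  bonus≤3a     0≤a (huge _ _)   = 0≤n·a 0≤a 3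

  half≤15a : ∀ {a} → 0# ≤ a → (s : Size a) → half s ≤ 15 · a
  half≤15a     0≤a (tiny _ _ _)     = 0≤n·a 0≤a 15
  half≤15a     0≤a (small _ _ _)  = 0≤n·a 0≤a 15
  half≤15a {a} 0≤a (medium p _) = linear (a ∷ S ∷ []) (5 ⊛ x₁) (15 ⊛ x₀) 0
    (5 ⊠ ⟨ x₁ ≲ 3 ⊛ x₀ ⟩ ≰⇒≥ p) ≡.refl
  half≤15a     0≤a (large _ _)  = 0≤n·a 0≤a 15
  half≤15a     0≤a (huge _ _)   = 0≤n·a 0≤a 15

  -- The source of the ratio 1.5: the bonus adds at most `3 · a`, with equality at 1/3, and `half`
  -- is largest relative to the size just above 1/3.
  rest≤15a : ∀ {a} → 0# ≤ a → ∀ light (s : Size a) → rest light s ≤ 15 · a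
  rest≤15a {a} 0≤a false s = linear (a ∷ fill s ∷ bonus s ∷ []) (x₁ ⊕ x₂) (15 ⊛ x₀) 0
    (⟨ x₁ ≲ 12 ⊛ x₀ ⟩ fill≤12a 0≤a s ⊞ ⟨ x₂ ≲ 3 ⊛ x₀ ⟩ bonus≤3a 0≤a s) ≡.refl
  rest≤15a     0≤a true  s = half≤15a 0≤a s

  bonus≤S : ∀ {a} (s : Size a) → bonus s ≤ S
  bonus≤S     (tiny _ _ _)     = 0≤S
  bonus≤S {a} (small _ _ q)  = linear (a ∷ S ∷ - S ∷ []) (6 ⊛ x₀ ⊕ x₂) x₁ 0
    (2 ⊠ ⟨ 3 ⊛ x₀ ≲ x₁ ⟩ q ⊞ ⟨ x₁ ⊕ x₂ ≲ ∅ ⟩ x-x≤0 S) ≡.refl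
  bonus≤S     (medium _ _) = ≤-refl
  bonus≤S     (large _ _)  = 0≤S
  bonus≤S     (huge _ _)   = 0≤S

  half≤5S : ∀ {a} (s : Size a) → half s ≤ 5 · S
  half≤5S (tiny _ _ _)     = 0≤n·a 0≤S 5
  half≤5S (small _ _ _)  = 0≤n·a 0≤S 5
  half≤5S (medium _ _) = ≤-refl
  half≤5S (large _ _)  = 0≤n·a 0≤S 5
  half≤5S (huge _ _)   = 0≤n·a 0≤S 5

  -- Superadditivity up to half the capacity

  module _ {a b} (0≤a : 0# ≤ a) (a≤b : a ≤ b) where

    private
      0≤b : 0# ≤ b
      0≤b = ≤-trans 0≤a a≤b

      6b≤S⇒6a≤S : 6 · b ≤ S → 6 · a ≤ S
      6b≤S⇒6a≤S = ≤-trans (·-monoʳ-≤ 6 a≤b)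

      3b≤S⇒3a≤S : 3 · b ≤ S → 3 · a ≤ S
      3b≤S⇒3a≤S = ≤-trans (·-monoʳ-≤ 3 a≤b)

      2b≤S⇒2a≤S : 2 · b ≤ S → 2 · a ≤ S
      2b≤S⇒2a≤S = ≤-trans (·-monoʳ-≤ 2 a≤b)

      6b≤S⇒3a≤S : 6 · b ≤ S → 3 · a ≤ S
      6b≤S⇒3a≤S 6b≤S = linear (a ∷ b ∷ S ∷ []) (3 ⊛ x₀) x₂ 0
        (⟨ 6 ⊛ x₁ ≲ x₂ ⟩ 6b≤S ⊞ 3 ⊠ ⟨ x₀ ≲ x₁ ⟩ a≤b ⊞ 3 ⊠ ⟨ ∅ ≲ x₁ ⟩ 0≤b) ≡.refl

    bonus-mono : 2 · b ≤ S → (s : Size a) (t : Size b) → bonus s ≤ bonus t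
    bonus-mono 2b≤S (tiny _ _ _)     t            = bonus≥0 t
    bonus-mono 2b≤S (small _ p _)  (tiny _ _ q)     = ⊥-elim (p (6b≤S⇒6a≤S q))
    bonus-mono 2b≤S (small _ p _)  (small _ _ _)  = linear (a ∷ b ∷ - S ∷ []) (6 ⊛ x₀ ⊕ x₂) (6 ⊛ x₁ ⊕ x₂) 0
      (6 ⊠ ⟨ x₀ ≲ x₁ ⟩ a≤b) ≡.refl
    bonus-mono 2b≤S s@(small _ _ _) (medium _ _) = bonus≤S s
    bonus-mono 2b≤S (medium p _) (tiny _ _ q)     = ⊥-elim (p (6b≤S⇒3a≤S q))
    bonus-mono 2b≤S (medium p _) (small _ _ q)  = ⊥-elim (p (3b≤S⇒3a≤S q))
    bonus-mono 2b≤S (medium _ _) (medium _ _) = ≤-refl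
    bonus-mono 2b≤S (large p _)  t            = ⊥-elim (p (2b≤S⇒2a≤S 2b≤S))
    bonus-mono 2b≤S (huge p _)   t            = ⊥-elim (p (2b≤S⇒2a≤S 2b≤S))
    bonus-mono 2b≤S s            (large p _)  = ⊥-elim (p 2b≤S)
    bonus-mono 2b≤S s            (huge p _)   = ⊥-elim (p 2b≤S)

    half-mono : 2 · b ≤ S → (s : Size a) (t : Size b) → half s ≤ half t
    half-mono 2b≤S (tiny _ _ _)     t            = half≥0 t
    half-mono 2b≤S (small _ _ _)  t            = half≥0 t
    half-mono 2b≤S (medium p _) (tiny _ _ q)     = ⊥-elim (p (6b≤S⇒3a≤S q))
    half-mono 2b≤S (medium p _) (small _ _ q)  = ⊥-elim (p (3b≤S⇒3a≤S q))
    half-mono 2b≤S (medium _ _) (medium _ _) = ≤-refl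
    half-mono 2b≤S (medium _ _) (large p _)  = ⊥-elim (p 2b≤S)
    half-mono 2b≤S (medium _ _) (huge p _)   = ⊥-elim (p 2b≤S)
    half-mono 2b≤S (large p _)  t            = half≥0 t
    half-mono 2b≤S (huge p _)   t            = half≥0 t

  module _ {a b} (0≤a : 0# ≤ a) (0≤b : 0# ≤ b) (2[a+b]≤S : 2 · (a + b) ≤ S) where

    private
      ≤bonusʳ : (t : Size b) (u : Size (a + b)) → 0# + bonus t ≤ bonus u
      ≤bonusʳ t u = ≤-trans (≤-reflexive (+-identityˡ _)) (bonus-mono 0≤b (x≤y+x 0≤a) 2[a+b]≤S t u)

      ≤bonusˡ : (s : Size a) (u : Size (a + b)) → bonus s + 0# ≤ bonus u
      ≤bonusˡ s u = ≤-trans (≤-reflexive (+-identityʳ _)) (bonus-mono 0≤a (x≤x+y 0≤b) 2[a+b]≤S s u)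

      ≤halfʳ : (t : Size b) (u : Size (a + b)) → 0# + half t ≤ half u
      ≤halfʳ t u = ≤-trans (≤-reflexive (+-identityˡ _)) (half-mono 0≤b (x≤y+x 0≤a) 2[a+b]≤S t u)

      ≤halfˡ : (s : Size a) (u : Size (a + b)) → half s + 0# ≤ half u
      ≤halfˡ s u = ≤-trans (≤-reflexive (+-identityʳ _)) (half-mono 0≤a (x≤x+y 0≤b) 2[a+b]≤S s u)

      mediumˡ⇒tinyʳ : ¬ 3 · a ≤ S → 6 · b ≤ S
      mediumˡ⇒tinyʳ p = linear (a ∷ b ∷ S ∷ []) (6 ⊛ x₁) x₂ 0
        (3 ⊠ ⟨ 2 ⊛ (x₀ ⊕ x₁) ≲ x₂ ⟩ 2[a+b]≤S ⊞ 2 ⊠ ⟨ x₂ ≲ 3 ⊛ x₀ ⟩ ≰⇒≥ p) ≡.refl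

      mediumʳ⇒tinyˡ : ¬ 3 · b ≤ S → 6 · a ≤ S
      mediumʳ⇒tinyˡ p = linear (a ∷ b ∷ S ∷ []) (6 ⊛ x₀) x₂ 0
        (3 ⊠ ⟨ 2 ⊛ (x₀ ⊕ x₁) ≲ x₂ ⟩ 2[a+b]≤S ⊞ 2 ⊠ ⟨ x₂ ≲ 3 ⊛ x₁ ⟩ ≰⇒≥ p) ≡.refl

      6b≤S⇒3b≤S : 6 · b ≤ S → 3 · b ≤ S
      6b≤S⇒3b≤S p = linear (b ∷ S ∷ []) (3 ⊛ x₀) x₁ 0
        (⟨ 6 ⊛ x₀ ≲ x₁ ⟩ p ⊞ 3 ⊠ ⟨ ∅ ≲ x₀ ⟩ 0≤b) ≡.refl

      2a≤S : 2 · a ≤ S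
      2a≤S = ≤-trans (·-monoʳ-≤ 2 (x≤x+y 0≤b)) 2[a+b]≤S

      2b≤S : 2 · b ≤ S
      2b≤S = ≤-trans (·-monoʳ-≤ 2 (x≤y+x 0≤a)) 2[a+b]≤S

    -- Within half the capacity a medium item leaves room only for tiny ones, which have no bonus.
    -- Two small items lose `S` twice; merged they lose it once if still small, and if medium,
    -- `6 · (a + b) ≤ 3 · S` bounds the sum by `S`. Hence such a load earns no more bonus than a
    -- single item of that size.
    bonus-superadditive : (s : Size a) (t : Size b) (u : Size (a + b)) → bonus s + bonus t ≤ bonus u
    bonus-superadditive (tiny _ _ _) t u = ≤bonusʳ t u
    bonus-superadditive s (tiny _ _ _) u = ≤bonusˡ s u
    bonus-superadditive (small _ p _) (small _ _ _) (tiny _ _ q) = ⊥-elim (p (≤-trans (·-monoʳ-≤ 6 (x≤x+y 0≤b)) q))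
    bonus-superadditive (small _ _ _) (small _ _ _) (small _ _ _) =
      linear (a ∷ b ∷ S ∷ - S ∷ []) (6 ⊛ x₀ ⊕ x₃ ⊕ (6 ⊛ x₁ ⊕ x₃)) (6 ⊛ (x₀ ⊕ x₁) ⊕ x₃) 0
        (⟨ x₂ ⊕ x₃ ≲ ∅ ⟩ x-x≤0 S ⊞ ⟨ ∅ ≲ x₂ ⟩ 0≤S) ≡.refl
    bonus-superadditive (small _ _ _) (small _ _ _) (medium _ _) =
      linear (a ∷ b ∷ S ∷ - S ∷ []) (6 ⊛ x₀ ⊕ x₃ ⊕ (6 ⊛ x₁ ⊕ x₃)) x₂ 0
        (2 ⊠ ⟨ x₂ ⊕ x₃ ≲ ∅ ⟩ x-x≤0 S ⊞ 3 ⊠ ⟨ 2 ⊛ (x₀ ⊕ x₁) ≲ x₂ ⟩ 2[a+b]≤S) ≡.refl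
    bonus-superadditive (small _ p _) (medium q _) u = ⊥-elim (p (mediumʳ⇒tinyˡ q))
    bonus-superadditive (medium p _) (small _ q _) u = ⊥-elim (q (mediumˡ⇒tinyʳ p))
    bonus-superadditive (medium p _) (medium q _) u = ⊥-elim (q (6b≤S⇒3b≤S (mediumˡ⇒tinyʳ p)))
    bonus-superadditive (large p _) t u = ⊥-elim (p 2a≤S)
    bonus-superadditive (huge p _) t u = ⊥-elim (p 2a≤S)
    bonus-superadditive s (large p _) u = ⊥-elim (p 2b≤S)
    bonus-superadditive s (huge p _) u = ⊥-elim (p 2b≤S)
    bonus-superadditive s t (large p _) = ⊥-elim (p 2[a+b]≤S)
    bonus-superadditive s t (huge p _) = ⊥-elim (p 2[a+b]≤S)

    -- Two medium items together exceed half the capacity.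
    half-superadditive : (s : Size a) (t : Size b) (u : Size (a + b)) → half s + half t ≤ half u
    half-superadditive (tiny _ _ _) t u = ≤halfʳ t u
    half-superadditive (small _ _ _) t u = ≤halfʳ t u
    half-superadditive (large _ _) t u = ≤halfʳ t u
    half-superadditive (huge _ _) t u = ≤halfʳ t u
    half-superadditive s (tiny _ _ _) u = ≤halfˡ s u
    half-superadditive s (small _ _ _) u = ≤halfˡ s u
    half-superadditive s (large _ _) u = ≤halfˡ s u
    half-superadditive s (huge _ _) u = ≤halfˡ s u
    half-superadditive (medium p _) (medium q _) u = ⊥-elim (q (6b≤S⇒3b≤S (mediumˡ⇒tinyʳ p)))

  rest≤0 : ∀ {a} light → ¬ 2 · a ≤ S → (s : Size a) → rest light s ≤ 0#
  rest≤0 false p (large _ _)  = ≤-reflexive (+-identityˡ 0#)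
  rest≤0 false p (huge _ _)   = ≤-reflexive (+-identityˡ 0#)
  rest≤0 true  p (large _ _)  = ≤-refl
  rest≤0 true  p (huge _ _)   = ≤-refl
  rest≤0 light p (medium _ q) = ⊥-elim (p q)
  rest≤0 light p (small q _ _) = ⊥-elim (p q)
  rest≤0 light p (tiny q _ _)  = ⊥-elim (p q)

  -- The weight of a bin with a large item

  gate : Bool → Carrier → Carrier
  gate true  a = a
  gate false a = 0#

  -- Meant for the total `rest` of items whose load `a` is at most half the capacity: they share one
  -- full bonus in an ordinary class and at most one of them is medium in a light one.
  restBound : Bool → Carrier → Carrier
  restBound false a = 12 · a + S
  restBound true  a = 5 · S

  -- `r` is the load beside the large item. The excess `8 · S - 12 · a` is chosen to balance the
  -- four cases: the light ones hold with equality, the others reduce to `a + r ≤ S`. Beside a huge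
  -- item `12 · r` is at most `4 · S`, which suffices without any excess.
  large-weight : ∀ light filled {a r} → ¬ 2 · a ≤ S → (s : Size a) → a + r ≤ S →
    top filled s + restBound light r + gate light (excess s) ≤ 15 · S + gate (not filled) (excess s)
  large-weight light  filled p (tiny q _ _)  a+r≤S = ⊥-elim (p q)
  large-weight light  filled p (small q _ _) a+r≤S = ⊥-elim (p q)
  large-weight light  filled p (medium _ q)  a+r≤S = ⊥-elim (p q)
  large-weight false  true  {a} {r} p (large _ _) a+r≤S = linear (a ∷ r ∷ S ∷ [])
    (2 ⊛ x₂ ⊕ 12 ⊛ x₀ ⊕ (12 ⊛ x₁ ⊕ x₂) ⊕ ∅) (15 ⊛ x₂ ⊕ ∅) 0
    (12 ⊠ ⟨ x₀ ⊕ x₁ ≲ x₂ ⟩ a+r≤S) ≡.refl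
  large-weight false  false {a} {r} p (large _ _) a+r≤S = linear (a ∷ r ∷ S ∷ - (3 · a) ∷ [])
    (10 ⊛ x₂ ⊕ (12 ⊛ x₁ ⊕ x₂) ⊕ ∅) (15 ⊛ x₂ ⊕ 4 ⊛ (2 ⊛ x₂ ⊕ x₃)) 0
    (12 ⊠ ⟨ x₀ ⊕ x₁ ≲ x₂ ⟩ a+r≤S ⊞ 4 ⊠ ⟨ ∅ ≲ 3 ⊛ x₀ ⊕ x₃ ⟩ 0≤x-x (3 · a)) ≡.refl
  large-weight true   true  {a} {r} p (large _ _) a+r≤S = linear (a ∷ S ∷ - (3 · a) ∷ [])
    (2 ⊛ x₁ ⊕ 12 ⊛ x₀ ⊕ 5 ⊛ x₁ ⊕ 4 ⊛ (2 ⊛ x₁ ⊕ x₂)) (15 ⊛ x₁ ⊕ ∅) 0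
    (4 ⊠ ⟨ 3 ⊛ x₀ ⊕ x₂ ≲ ∅ ⟩ x-x≤0 (3 · a)) ≡.refl
  large-weight true   false {a} {r} p s@(large _ _) a+r≤S = linear (S ∷ excess s ∷ [])
    (10 ⊛ x₀ ⊕ 5 ⊛ x₀ ⊕ x₁) (15 ⊛ x₀ ⊕ x₁) 0
    (⟨ ∅ ≲ ∅ ⟩ ≤-refl) ≡.refl
  large-weight false  true  {a} {r} p (huge _ q) a+r≤S = linear (a ∷ r ∷ S ∷ [])
    (10 ⊛ x₂ ⊕ (12 ⊛ x₁ ⊕ x₂) ⊕ ∅) (15 ⊛ x₂ ⊕ ∅) 0
    (12 ⊠ ⟨ x₀ ⊕ x₁ ≲ x₂ ⟩ a+r≤S ⊞ 4 ⊠ ⟨ 2 ⊛ x₂ ≲ 3 ⊛ x₀ ⟩ q) ≡.refl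
  large-weight false  false {a} {r} p (huge _ q) a+r≤S = linear (a ∷ r ∷ S ∷ [])
    (10 ⊛ x₂ ⊕ (12 ⊛ x₁ ⊕ x₂) ⊕ ∅) (15 ⊛ x₂ ⊕ ∅) 0
    (12 ⊠ ⟨ x₀ ⊕ x₁ ≲ x₂ ⟩ a+r≤S ⊞ 4 ⊠ ⟨ 2 ⊛ x₂ ≲ 3 ⊛ x₀ ⟩ q) ≡.refl
  large-weight true   true  p (huge _ _) a+r≤S = linear (S ∷ [])
    (10 ⊛ x₀ ⊕ 5 ⊛ x₀ ⊕ ∅) (15 ⊛ x₀ ⊕ ∅) 0 (⟨ ∅ ≲ ∅ ⟩ ≤-refl) ≡.refl
  large-weight true   false p (huge _ _) a+r≤S = linear (S ∷ [])
    (10 ⊛ x₀ ⊕ 5 ⊛ x₀ ⊕ ∅) (15 ⊛ x₀ ⊕ ∅) 0 (⟨ ∅ ≲ ∅ ⟩ ≤-refl) ≡.refl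

  excess≤2S : ∀ {a} (s : Size a) → excess s ≤ 2 · S
  excess≤2S (tiny _ _ _)  = 0≤n·a 0≤S 2
  excess≤2S (small _ _ _) = 0≤n·a 0≤S 2
  excess≤2S (medium _ _)  = 0≤n·a 0≤S 2
  excess≤2S {a} (large p _) = linear (a ∷ S ∷ - (3 · a) ∷ []) (4 ⊛ (2 ⊛ x₁ ⊕ x₂)) (2 ⊛ x₁) 0
    (4 ⊠ ⟨ 3 ⊛ x₀ ⊕ x₂ ≲ ∅ ⟩ x-x≤0 (3 · a) ⊞ 6 ⊠ ⟨ x₁ ≲ 2 ⊛ x₀ ⟩ ≰⇒≥ p) ≡.refl
  excess≤2S (huge _ _)    = 0≤n·a 0≤S 2

  -- `fill` restricted to the items up to 1/3. In a light class its total is at most `2 · S`, so it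
  -- can be written off.
  scrap : ∀ {a} → Size a → Carrier
  scrap {a} (tiny _ _ _)  = 12 · a
  scrap {a} (small _ _ _) = 12 · a
  scrap     (medium _ _)  = 0#
  scrap     (large _ _)   = 0#
  scrap     (huge _ _)    = 0#

  scrap≥0 : ∀ {a} → 0# ≤ a → (s : Size a) → 0# ≤ scrap s
  scrap≥0 0≤a (tiny _ _ _)  = 0≤n·a 0≤a 12
  scrap≥0 0≤a (small _ _ _) = 0≤n·a 0≤a 12
  scrap≥0 0≤a (medium _ _)  = ≤-refl
  scrap≥0 0≤a (large _ _)   = ≤-refl
  scrap≥0 0≤a (huge _ _)    = ≤-refl

  fill≤scrap : ∀ {a} → (¬ 3 · a ≤ S → ¬ 2 · a ≤ S) → (s : Size a) → fill s ≤ scrap s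
  fill≤scrap p (tiny _ _ _)  = ≤-refl
  fill≤scrap p (small _ _ _) = ≤-refl
  fill≤scrap p (medium q r)  = ⊥-elim (p q r)
  fill≤scrap p (large _ _)   = ≤-refl
  fill≤scrap p (huge _ _)    = ≤-refl

  5S≤half : ∀ {a} → ¬ 3 · a ≤ S → 2 · a ≤ S → (s : Size a) → 5 · S ≤ half s
  5S≤half p q (tiny _ r _)  = ⊥-elim (p r)
  5S≤half p q (small _ _ r) = ⊥-elim (p r)
  5S≤half p q (medium _ _)  = ≤-refl
  5S≤half p q (large r _)   = ⊥-elim (r q)
  5S≤half p q (huge r _)    = ⊥-elim (r q)

  S≤bonus : ∀ {a} → ¬ 3 · a ≤ S → 2 · a ≤ S → (s : Size a) → S ≤ bonus s
  S≤bonus p q (tiny _ r _)  = ⊥-elim (p r)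
  S≤bonus p q (small _ _ r) = ⊥-elim (p r)
  S≤bonus p q (medium _ _)  = ≤-refl
  S≤bonus p q (large r _)   = ⊥-elim (r q)
  S≤bonus p q (huge r _)    = ⊥-elim (r q)

  5S≤rest : ∀ {a} → 0# ≤ a → ¬ 3 · a ≤ S → 2 · a ≤ S → ∀ light (s : Size a) → 5 · S ≤ rest light s
  5S≤rest     0≤a p q true  s = 5S≤half p q s
  5S≤rest {a} 0≤a p q false s = linear (a ∷ S ∷ fill s ∷ bonus s ∷ []) (5 ⊛ x₁) (x₂ ⊕ x₃) 0
    (⟨ 12 ⊛ x₀ ≲ x₂ ⟩ ≤-reflexive (≈-sym (fill≈12a q s)) ⊞ ⟨ x₁ ≲ x₃ ⟩ S≤bonus p q s
      ⊞ 4 ⊠ ⟨ x₁ ≲ 3 ⊛ x₀ ⟩ ≰⇒≥ p) ≡.refl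

  -- An item overflowing a bin that is two-thirds full supplies half of what is needed there: a tiny
  -- one forces `b` to at least 5/6, for a small one `6 · (a + b)` reaches `6 · S`, and a medium one
  -- has the whole bonus `S`. Two such items complete the weight `10 · S`.
  5S≤6b+bonus : ∀ {a b} → ¬ a + b ≤ S → 2 · S ≤ 3 · b → 2 · a ≤ S → (s : Size a) →
                5 · S ≤ 6 · b + bonus s
  5S≤6b+bonus {a} {b} p q r (tiny _ _ t) = linear (a ∷ b ∷ S ∷ []) (5 ⊛ x₂) (6 ⊛ x₁ ⊕ ∅) 0
    (6 ⊠ ⟨ x₂ ≲ x₀ ⊕ x₁ ⟩ ≰⇒≥ p ⊞ ⟨ 6 ⊛ x₀ ≲ x₂ ⟩ t) ≡.refl
  5S≤6b+bonus {a} {b} p q r (small _ _ _) = linear (a ∷ b ∷ S ∷ - S ∷ []) (5 ⊛ x₂) (6 ⊛ x₁ ⊕ (6 ⊛ x₀ ⊕ x₃)) 0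
    (6 ⊠ ⟨ x₂ ≲ x₀ ⊕ x₁ ⟩ ≰⇒≥ p ⊞ ⟨ ∅ ≲ x₂ ⊕ x₃ ⟩ 0≤x-x S) ≡.refl
  5S≤6b+bonus {a} {b} p q r (medium _ _) = linear (b ∷ S ∷ []) (5 ⊛ x₁) (6 ⊛ x₀ ⊕ x₁) 0
    (2 ⊠ ⟨ 2 ⊛ x₁ ≲ 3 ⊛ x₀ ⟩ q) ≡.refl
  5S≤6b+bonus p q r (large t _) = ⊥-elim (t r)
  5S≤6b+bonus p q r (huge t _)  = ⊥-elim (t r)

  10S≤top+ : ∀ filled {a b} → 0# ≤ b → (filled ≡ true → 8 · S ≤ 12 · a + b) →
             ¬ 2 · a ≤ S → (s : Size a) → 10 · S ≤ top filled s + b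
  10S≤top+ filled 0≤b p q (tiny r _ _)  = ⊥-elim (q r)
  10S≤top+ filled 0≤b p q (small r _ _) = ⊥-elim (q r)
  10S≤top+ filled 0≤b p q (medium _ r)  = ⊥-elim (q r)
  10S≤top+ true {a} {b} 0≤b p q (large _ _) = linear (a ∷ b ∷ S ∷ []) (10 ⊛ x₂) (2 ⊛ x₂ ⊕ 12 ⊛ x₀ ⊕ x₁) 0
    (⟨ 8 ⊛ x₂ ≲ 12 ⊛ x₀ ⊕ x₁ ⟩ p ≡.refl) ≡.refl
  10S≤top+ false 0≤b p q (large _ _) = x≤x+y 0≤b
  10S≤top+ filled 0≤b p q (huge _ _) = x≤x+y 0≤b

  10S≤top+5S : ∀ filled {a} → ¬ 2 · a ≤ S → (s : Size a) → 10 · S ≤ top filled s + 5 · S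
  10S≤top+5S filled {a} p s = 10S≤top+ filled (0≤n·a 0≤S 5) (λ _ → linear (a ∷ S ∷ []) (8 ⊛ x₁) (12 ⊛ x₀ ⊕ 5 ⊛ x₁) 0
    (6 ⊠ ⟨ x₁ ≲ 2 ⊛ x₀ ⟩ ≰⇒≥ p ⊞ 3 ⊠ ⟨ ∅ ≲ x₁ ⟩ 0≤S) ≡.refl) p s

  fill≤0 : ∀ {a} → ¬ 2 · a ≤ S → (s : Size a) → fill s ≤ 0#
  fill≤0 p (tiny q _ _)  = ⊥-elim (p q)
  fill≤0 p (small q _ _) = ⊥-elim (p q)
  fill≤0 p (medium _ q)  = ⊥-elim (p q)
  fill≤0 p (large _ _)   = ≤-refl
  fill≤0 p (huge _ _)    = ≤-refl

  scrap≤12a : ∀ {a} → 0# ≤ a → (s : Size a) → scrap s ≤ 12 · a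
  scrap≤12a 0≤a (tiny _ _ _)  = ≤-refl
  scrap≤12a 0≤a (small _ _ _) = ≤-refl
  scrap≤12a 0≤a (medium _ _)  = 0≤n·a 0≤a 12
  scrap≤12a 0≤a (large _ _)   = 0≤n·a 0≤a 12
  scrap≤12a 0≤a (huge _ _)    = 0≤n·a 0≤a 12

  scrap≤0 : ∀ {a} → ¬ 3 · a ≤ S → (s : Size a) → scrap s ≤ 0#
  scrap≤0 p (tiny _ q _)  = ⊥-elim (p q)
  scrap≤0 p (small _ _ q) = ⊥-elim (p q)
  scrap≤0 p (medium _ _)  = ≤-refl
  scrap≤0 p (large _ _)   = ≤-refl
  scrap≤0 p (huge _ _)    = ≤-refl

-- First-Fit on k instances

module Analysis {c ℓ₁ ℓ₂ : Level} (G : OrderedAbelianGroup c ℓ₁ ℓ₂)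
                {n : ℕ} (D : Vector (OrderedAbelianGroup.Carrier G) n)
                (S : OrderedAbelianGroup.Carrier G)
                (0≤S : OrderedAbelianGroup._≤_ G (OrderedAbelianGroup.0# G) S)
                (0≤D : ∀ i → OrderedAbelianGroup._≤_ G (OrderedAbelianGroup.0# G) (D i))
                (D≤S : ∀ i → OrderedAbelianGroup._≤_ G (D i) S) where

  open OrderedAbelianGroup G
  open LinearArithmetic G
  open Sums G
  open Weights G S 0≤S
  open BinPacking G D S

  -- The weight of a bin of the optimal packing

  sizeOf : (i : Item) → Size (D i)
  sizeOf i = size (D i)

  weightOf : Bool → Bool → Item → Carrier
  weightOf light filled i = weight light filled (sizeOf i)

  Φ : Bin → Carrier
  Φ = ∑ (excess ∘ sizeOf)

  NonLarge Large : Item → Set ℓ₂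
  NonLarge i = 2 · D i ≤ S
  Large i    = ¬ NonLarge i

  large? : ∀ i → Dec (Large i)
  large? i = ¬? (2 · D i ≤? S)

  load≥0 : ∀ b → 0# ≤ load b
  load≥0 = ∑-nonneg 0≤D

  noneLarge : ∀ {b} → ¬ Any Large b → All NonLarge b
  noneLarge none = All.map (decidable-stable (2 · D _ ≤? S)) (¬Any⇒All¬ _ none)

  light⇒noneLarge : ∀ b → 2 · load b ≤ S → All NonLarge b
  light⇒noneLarge b 2load≤S = All.tabulate λ i∈b → ≤-trans (·-monoʳ-≤ 2 (∈⇒≤∑ 0≤D i∈b)) 2load≤S

  ∑bonus≤bonus-load : ∀ b → 2 · load b ≤ S → ∑ (bonus ∘ sizeOf) b ≤ bonus (size (load b))
  ∑bonus≤bonus-load []      _ = bonus≥0 (size 0#)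
  ∑bonus≤bonus-load (i ∷ b) p = ≤-trans
    (+-monoʳ-≤ _ (∑bonus≤bonus-load b (≤-trans (·-monoʳ-≤ 2 (x≤y+x (0≤D i))) p)))
    (bonus-superadditive (0≤D i) (load≥0 b) p (sizeOf i) (size (load b)) (size (load (i ∷ b))))

  ∑half≤half-load : ∀ b → 2 · load b ≤ S → ∑ (half ∘ sizeOf) b ≤ half (size (load b))
  ∑half≤half-load []      _ = half≥0 (size 0#)
  ∑half≤half-load (i ∷ b) p = ≤-trans
    (+-monoʳ-≤ _ (∑half≤half-load b (≤-trans (·-monoʳ-≤ 2 (x≤y+x (0≤D i))) p)))
    (half-superadditive (0≤D i) (load≥0 b) p (sizeOf i) (size (load b)) (size (load (i ∷ b))))

  ∑rest≤restBound : ∀ light b → 2 · load b ≤ S → ∑ (rest light ∘ sizeOf) b ≤ restBound light (load b)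
  ∑rest≤restBound true  b p = ≤-trans (∑half≤half-load b p) (half≤5S (size (load b)))
  ∑rest≤restBound false b p = ≤-trans (≤-reflexive (∑-+ _ _ b)) (+-mono-≤
    (≤-trans (∑-mono (λ i → fill≤12a (0≤D i) (sizeOf i)) b) (≤-reflexive (∑-· 12 D b)))
    (≤-trans (∑bonus≤bonus-load b p) (bonus≤S (size (load b)))))

  -- At most half the capacity is left beside `x`, so `others` contains no large item and
  -- superadditivity applies to it.
  record LargeSplit (b : Bin) (x : Item) : Set (c ⊔ ℓ₁ ⊔ ℓ₂) where
    field
      others       : Bin
      split        : ∀ g → ∑ g b ≈ g x + ∑ g others
      isLarge      : Large x
      2others≤S    : 2 · load others ≤ S

  largeSplit : ∀ {b x} → load b ≤ S → Large x → x ∈ b → LargeSplit b x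
  largeSplit {b} {x} load≤S lx x∈b with ∑-extract x∈b
  ... | ys , eq , _ = record
    { others = ys ; split = eq ; isLarge = lx
    ; 2others≤S = linear (D x ∷ load ys ∷ load b ∷ S ∷ []) (2 ⊛ x₁) x₃ 0
        (2 ⊠ ⟨ x₀ ⊕ x₁ ≲ x₂ ⟩ ≤-reflexive (≈-sym (eq D)) ⊞ 2 ⊠ ⟨ x₂ ≲ x₃ ⟩ load≤S
          ⊞ ⟨ x₃ ≲ 2 ⊛ x₀ ⟩ ≰⇒≥ lx) ≡.refl }

  Φ-noneLarge : ∀ {b} → All NonLarge b → Φ b ≈ 0#
  Φ-noneLarge none = ∑-0 (All.map (λ p → excess≈0 p (sizeOf _)) none)

  module _ {b x} (sp : LargeSplit b x) where
    open LargeSplit sp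

    Φ-split : Φ b ≈ excess (sizeOf x)
    Φ-split = ≈-trans (split _)
      (≈-trans (+-cong ≈-refl (Φ-noneLarge (light⇒noneLarge others 2others≤S))) (+-identityʳ _))

    weight-split : ∀ light filled → ∑ (weightOf light filled) b ≤ top filled (sizeOf x) + restBound light (load others)
    weight-split light filled = ≤-trans (≤-reflexive (split _)) (+-mono-≤
      (≤-trans (+-monoʳ-≤ _ (rest≤0 light isLarge (sizeOf x))) (≤-reflexive (+-identityʳ _)))
      (≤-trans (∑-mono-All (All.map (λ {i} p → top-free i p) (light⇒noneLarge others 2others≤S)))
        (∑rest≤restBound light others 2others≤S)))
      where
      top-free : ∀ i → NonLarge i → weightOf light filled i ≤ rest light (sizeOf i)
      top-free i p = ≤-reflexive (≈-trans (+-cong (top≈0 p filled (sizeOf i)) ≈-refl) (+-identityˡ _))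

  -- Without a large item the factor 1.5 of `rest≤15a` suffices; otherwise there is exactly one, and
  -- `large-weight` applies. The gated excess is kept on both sides so that it telescopes over
  -- consecutive classes.
  bin-weight : ∀ light filled b → load b ≤ S →
               ∑ (weightOf light filled) b + gate light (Φ b) ≤ 15 · S + gate (not filled) (Φ b)
  bin-weight light filled b load≤S with any? large? b
  ... | no none = ≤-trans (+-mono-≤ weight≤15S (gate-noneLarge light)) (+-monoʳ-≤ _ (gate≥0 (not filled)))
    where
    top-free : ∀ i → NonLarge i → weightOf light filled i ≤ 15 · D i
    top-free i p = ≤-trans
      (≤-reflexive (≈-trans (+-cong (top≈0 p filled (sizeOf i)) ≈-refl) (+-identityˡ _)))
      (rest≤15a (0≤D i) light (sizeOf i))
    weight≤15S : ∑ (weightOf light filled) b ≤ 15 · S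
    weight≤15S = ≤-trans (∑-mono-All (All.map (λ {i} p → top-free i p) (noneLarge none)))
      (≤-trans (≤-reflexive (∑-· 15 D b)) (·-monoʳ-≤ 15 load≤S))
    gate-noneLarge : ∀ l → gate l (Φ b) ≤ 0#
    gate-noneLarge true  = ≤-reflexive (Φ-noneLarge (noneLarge none))
    gate-noneLarge false = ≤-refl
    gate≥0 : ∀ l → 0# ≤ gate l (Φ b)
    gate≥0 true  = ∑-nonneg (λ i → excess≥0 (sizeOf i)) b
    gate≥0 false = ≤-refl
  ... | yes some with find some
  ... | x , x∈b , lx = ≤-trans
    (+-mono-≤ (weight-split sp light filled) (gate-cong light (Φ-split sp)))
    (≤-trans (large-weight light filled lx (sizeOf x)
               (≤-trans (≤-reflexive (≈-sym (split D))) load≤S))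
      (+-monoʳ-≤ _ (gate-cong (not filled) (≈-sym (Φ-split sp)))))
    where
    sp : LargeSplit b x
    sp = largeSplit load≤S lx x∈b
    open LargeSplit sp
    gate-cong : ∀ l {x y} → x ≈ y → gate l x ≤ gate l y
    gate-cong true  = ≤-reflexive
    gate-cong false _ = ≤-refl

  Φ≤2S : ∀ b → load b ≤ S → Φ b ≤ 2 · S
  Φ≤2S b load≤S with any? large? b
  ... | no none = ≤-trans (≤-reflexive (Φ-noneLarge (noneLarge none))) (0≤n·a 0≤S 2)
  ... | yes some with find some
  ... | x , x∈b , lx = ≤-trans (≤-reflexive (Φ-split (largeSplit load≤S lx x∈b))) (excess≤2S (sizeOf x))

  -- Bins without large items

  Medium : Item → Set ℓ₂
  Medium i = ¬ 3 · D i ≤ S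

  NonEmpty : Bin → Set
  NonEmpty b = b ≢ []

  -- `AllPairs _Overflows_` is the First-Fit rule inside one class, where items are distinct and are
  -- turned away only for lack of room. It survives growth of `b`, so final loads may be used.
  _Overflows_ : Bin → Bin → Set ℓ₂
  b Overflows b′ = All (λ i → ¬ D i + load b ≤ S) b′

  ten : Bin → Carrier
  ten _ = 10 · S

  ∑∑ : (Item → Carrier) → List Bin → Carrier
  ∑∑ g = ∑ (∑ g)

  restOf : Bool → Item → Carrier
  restOf light i = rest light (sizeOf i)

  restOf≥0 : ∀ light i → 0# ≤ restOf light i
  restOf≥0 light i = rest≥0 (0≤D i) light (sizeOf i)

  -- Two items of at most half the capacity share a bin, so among bins without large items only the
  -- last can hold a single item.
  singleton-last : ∀ {i b} → NonLarge i → All NonLarge b → NonEmpty b → ¬ (i ∷ []) Overflows b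
  singleton-last p []       nonEmpty _ = nonEmpty ≡.refl
  singleton-last {i} p (_∷_ {j} q _) _ (o ∷ _) = o (linear (D i ∷ D j ∷ S ∷ []) (x₁ ⊕ (x₀ ⊕ ∅)) x₂ 1
    (⟨ 2 ⊛ x₀ ≲ x₂ ⟩ p ⊞ ⟨ 2 ⊛ x₁ ≲ x₂ ⟩ q) ≡.refl)

  -- By `singleton-last` every bin but the last has two items, each with `rest` at least `5 · S`.
  count-medium : ∀ light {bs} → AllPairs _Overflows_ bs → All NonEmpty bs →
                 All (All NonLarge) bs → All (All Medium) bs →
                 ∑ ten bs ≤ ∑∑ (restOf light) bs + 10 · S
  count-medium light [] _ _ _ = linear (S ∷ []) ∅ (∅ ⊕ 10 ⊛ x₀) 0 (10 ⊠ ⟨ ∅ ≲ x₀ ⟩ 0≤S) ≡.refl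
  count-medium light {[] ∷ bs} _ (nonEmpty ∷ _) _ _ = ⊥-elim (nonEmpty ≡.refl)
  count-medium light {(i ∷ []) ∷ []} _ _ _ _ = linear (S ∷ restOf light i ∷ []) (10 ⊛ x₀ ⊕ ∅) ((x₁ ⊕ ∅) ⊕ ∅ ⊕ 10 ⊛ x₀) 0
    (⟨ ∅ ≲ x₁ ⟩ restOf≥0 light i) ≡.refl
  count-medium light {(i ∷ []) ∷ b ∷ bs} ((o ∷ _) ∷ _) (_ ∷ nonEmpty ∷ _) ((p ∷ _) ∷ q ∷ _) _ =
    ⊥-elim (singleton-last p q nonEmpty o)
  count-medium light {(i ∷ j ∷ b) ∷ bs} (_ ∷ os) (_ ∷ nes) ((p ∷ q ∷ _) ∷ ps) ((s ∷ t ∷ _) ∷ ms) =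
    linear (S ∷ restOf light i ∷ restOf light j ∷ ∑ (restOf light) b ∷ ∑ ten bs ∷ ∑∑ (restOf light) bs ∷ [])
      (10 ⊛ x₀ ⊕ x₄) ((x₁ ⊕ (x₂ ⊕ x₃)) ⊕ x₅ ⊕ 10 ⊛ x₀) 0
      (⟨ 5 ⊛ x₀ ≲ x₁ ⟩ 5S≤rest (0≤D i) s p light (sizeOf i)
        ⊞ ⟨ 5 ⊛ x₀ ≲ x₂ ⟩ 5S≤rest (0≤D j) t q light (sizeOf j)
        ⊞ ⟨ ∅ ≲ x₃ ⟩ ∑-nonneg (restOf≥0 light) b
        ⊞ ⟨ x₄ ≲ x₅ ⊕ 10 ⊛ x₀ ⟩ count-medium light os nes ps ms) ≡.refl

  overflow⇒medium : ∀ b {b′} → 3 · load b ≤ 2 · S → b Overflows b′ → All Medium b′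
  overflow⇒medium b p = All.map λ {i} o q → o (linear (D i ∷ load b ∷ S ∷ []) (x₀ ⊕ x₁) x₂ 2
    (⟨ 3 ⊛ x₀ ≲ x₂ ⟩ q ⊞ ⟨ 3 ⊛ x₁ ≲ 2 ⊛ x₂ ⟩ p) ≡.refl)

  bonusOf : Item → Carrier
  bonusOf i = bonus (sizeOf i)

  ∑fill : Bin → Carrier
  ∑fill = ∑ (fill ∘ sizeOf)

  ∑fill-nonLarge : ∀ {b} → All NonLarge b → ∑fill b ≈ 12 · load b
  ∑fill-nonLarge []               = ≈-sym (·-zeroʳ 12)
  ∑fill-nonLarge {i ∷ b} (p ∷ ps) =
    ≈-trans (+-cong (fill≈12a p (sizeOf i)) (∑fill-nonLarge ps)) (≈-sym (×-distrib-+ (D i) (load b) 12))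

  ∑rest-nonLarge : ∀ {b} → All NonLarge b → ∑ (restOf false) b ≈ 12 · load b + ∑ bonusOf b
  ∑rest-nonLarge {b} ps = ≈-trans (∑-+ _ _ b) (+-cong (∑fill-nonLarge ps) ≈-refl)

  -- The bonus of the next bin makes up for the free space of a bin that is at
  -- least two-thirds full.
  count-chain : ∀ {b bs} → AllPairs _Overflows_ (b ∷ bs) → All NonEmpty bs → All (All NonLarge) (b ∷ bs) →
                ∑ ten (b ∷ bs) ≤ 12 · load b + ∑∑ (restOf false) bs + 30 · S
  count-chain {b} {[]} _ _ _ = linear (S ∷ load b ∷ []) (10 ⊛ x₀ ⊕ ∅) (12 ⊛ x₁ ⊕ ∅ ⊕ 30 ⊛ x₀) 0
    (20 ⊠ ⟨ ∅ ≲ x₀ ⟩ 0≤S ⊞ 12 ⊠ ⟨ ∅ ≲ x₁ ⟩ load≥0 b) ≡.refl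
  count-chain {b} {b₁ ∷ bs} (o ∷ os) nes (p ∷ ps) with 2 · S ≤? 3 · load b
  -- Below two-thirds, all later bins hold only medium items, so the chain ends at the cost of this
  -- bin and the last one.
  ... | no ¬full = linear (S ∷ load b ∷ ∑ ten (b₁ ∷ bs) ∷ ∑∑ (restOf false) (b₁ ∷ bs) ∷ [])
    (10 ⊛ x₀ ⊕ x₂) (12 ⊛ x₁ ⊕ x₃ ⊕ 30 ⊛ x₀) 0
    (⟨ x₂ ≲ x₃ ⊕ 10 ⊛ x₀ ⟩ count-medium false os nes ps (All.map (overflow⇒medium b (≰⇒≥ ¬full)) o)
      ⊞ 10 ⊠ ⟨ ∅ ≲ x₀ ⟩ 0≤S ⊞ 12 ⊠ ⟨ ∅ ≲ x₁ ⟩ load≥0 b) ≡.refl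
  count-chain {b} {[] ∷ bs} _ (nonEmpty ∷ _) _ | yes full = ⊥-elim (nonEmpty ≡.refl)
  count-chain {b} {(i ∷ []) ∷ []} _ _ _ | yes full = linear (S ∷ load b ∷ restOf false i ∷ [])
    (10 ⊛ x₀ ⊕ (10 ⊛ x₀ ⊕ ∅)) (12 ⊛ x₁ ⊕ (x₂ ⊕ ∅ ⊕ ∅) ⊕ 30 ⊛ x₀) 0
    (10 ⊠ ⟨ ∅ ≲ x₀ ⟩ 0≤S ⊞ 12 ⊠ ⟨ ∅ ≲ x₁ ⟩ load≥0 b ⊞ ⟨ ∅ ≲ x₂ ⟩ restOf≥0 false i) ≡.refl
  count-chain {b} {(i ∷ []) ∷ b₂ ∷ bs} (_ ∷ (o ∷ _) ∷ _) (_ ∷ nonEmpty ∷ _) (_ ∷ (p ∷ _) ∷ q ∷ _) | yes full =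
    ⊥-elim (singleton-last p q nonEmpty o)
  -- The bonuses of `i` and `j` are spent on `b`, so the recursion starts from `12 · load b₁` alone.
  count-chain {b} {b₁@(i ∷ j ∷ b′) ∷ bs} (((oᵢ ∷ oⱼ ∷ _) ∷ _) ∷ os) (_ ∷ nes) (_ ∷ p@(pᵢ ∷ pⱼ ∷ _) ∷ ps) | yes full =
    linear (S ∷ load b ∷ bonusOf i ∷ bonusOf j ∷ ∑ bonusOf b′ ∷ load b₁ ∷ ∑ (restOf false) b₁ ∷ ∑ ten bs ∷ ∑∑ (restOf false) bs ∷ [])
      (10 ⊛ x₀ ⊕ (10 ⊛ x₀ ⊕ x₇)) (12 ⊛ x₁ ⊕ (x₆ ⊕ x₈) ⊕ 30 ⊛ x₀) 0
      (⟨ 5 ⊛ x₀ ≲ 6 ⊛ x₁ ⊕ x₂ ⟩ 5S≤6b+bonus oᵢ full pᵢ (sizeOf i)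
        ⊞ ⟨ 5 ⊛ x₀ ≲ 6 ⊛ x₁ ⊕ x₃ ⟩ 5S≤6b+bonus oⱼ full pⱼ (sizeOf j)
        ⊞ ⟨ ∅ ≲ x₄ ⟩ ∑-nonneg (λ i → bonus≥0 (sizeOf i)) b′
        ⊞ ⟨ 12 ⊛ x₅ ⊕ (x₂ ⊕ (x₃ ⊕ x₄)) ≲ x₆ ⟩ ≤-reflexive (≈-sym (∑rest-nonLarge p))
        ⊞ ⟨ 10 ⊛ x₀ ⊕ x₇ ≲ 12 ⊛ x₅ ⊕ x₈ ⊕ 30 ⊛ x₀ ⟩ count-chain os nes (p ∷ ps)) ≡.refl

  -- The alternatives are: no medium item, exactly one, at least two.
  mediums : ∀ {b} → All NonLarge b →
            12 · load b ≤ ∑ (scrap ∘ sizeOf) b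
            ⊎ (12 · load b ≤ 6 · S + ∑ (scrap ∘ sizeOf) b × 5 · S ≤ ∑ (restOf true) b)
            ⊎ 10 · S ≤ ∑ (restOf true) b
  mediums [] = inj₁ (≤-reflexive (·-zeroʳ 12))
  mediums {i ∷ b} (p ∷ ps) = step (sizeOf i) (mediums ps)
    where
    X Y : Carrier
    X = ∑ (scrap ∘ sizeOf) b
    Y = ∑ (restOf true) b
    add : 12 · load b ≤ X → 12 · (D i + load b) ≤ 12 · D i + X
    add q = linear (D i ∷ load b ∷ X ∷ []) (12 ⊛ (x₀ ⊕ x₁)) (12 ⊛ x₀ ⊕ x₂) 0 (⟨ 12 ⊛ x₁ ≲ x₂ ⟩ q) ≡.refl
    add+6S : 12 · load b ≤ 6 · S + X → 12 · (D i + load b) ≤ 6 · S + (12 · D i + X)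
    add+6S q = linear (D i ∷ load b ∷ S ∷ X ∷ []) (12 ⊛ (x₀ ⊕ x₁)) (6 ⊛ x₂ ⊕ (12 ⊛ x₀ ⊕ x₃)) 0
      (⟨ 12 ⊛ x₁ ≲ 6 ⊛ x₂ ⊕ x₃ ⟩ q) ≡.refl
    step : (s : Size (D i)) →
           12 · load b ≤ X ⊎ (12 · load b ≤ 6 · S + X × 5 · S ≤ Y) ⊎ 10 · S ≤ Y →
           12 · (D i + load b) ≤ scrap s + X
           ⊎ (12 · (D i + load b) ≤ 6 · S + (scrap s + X) × 5 · S ≤ half s + Y)
           ⊎ 10 · S ≤ half s + Y
    step s (inj₂ (inj₂ q)) = inj₂ (inj₂ (≤-trans q (x≤y+x (half≥0 s))))
    step s@(medium _ t) (inj₁ q) = inj₂ (inj₁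
      ( linear (D i ∷ load b ∷ S ∷ X ∷ []) (12 ⊛ (x₀ ⊕ x₁)) (6 ⊛ x₂ ⊕ (∅ ⊕ x₃)) 0
          (⟨ 12 ⊛ x₁ ≲ x₃ ⟩ q ⊞ 6 ⊠ ⟨ 2 ⊛ x₀ ≲ x₂ ⟩ t) ≡.refl
      , x≤x+y (∑-nonneg (restOf≥0 true) b)))
    step s@(medium _ _) (inj₂ (inj₁ (_ , q))) = inj₂ (inj₂ (linear (S ∷ Y ∷ []) (10 ⊛ x₀) (5 ⊛ x₀ ⊕ x₁) 0
      (⟨ 5 ⊛ x₀ ≲ x₁ ⟩ q) ≡.refl))
    step (tiny _ _ _)  (inj₁ q)              = inj₁ (add q)
    step (small _ _ _) (inj₁ q)              = inj₁ (add q)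
    step (tiny _ _ _)  (inj₂ (inj₁ (q , t))) = inj₂ (inj₁ (add+6S q , ≤-trans t (x≤y+x ≤-refl)))
    step (small _ _ _) (inj₂ (inj₁ (q , t))) = inj₂ (inj₁ (add+6S q , ≤-trans t (x≤y+x ≤-refl)))
    step (large t _)   q                     = ⊥-elim (t p)
    step (huge t _)    q                     = ⊥-elim (t p)

  -- A bin with two medium items weighs `10 · S`. One with fewer has load at most 1/2 + 1/6 = 2/3,
  -- its scrap being at most `2 · S` at rate 12; then all later bins hold only medium items. The
  -- loss is that bin and the last one.
  count-light : ∀ {bs} → AllPairs _Overflows_ bs → All NonEmpty bs → All (All NonLarge) bs →
                All (λ b → ∑ (scrap ∘ sizeOf) b ≤ 2 · S) bs →
                ∑ ten bs ≤ ∑∑ (restOf true) bs + 20 · S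
  count-light [] _ _ _ = linear (S ∷ []) ∅ (∅ ⊕ 20 ⊛ x₀) 0 (20 ⊠ ⟨ ∅ ≲ x₀ ⟩ 0≤S) ≡.refl
  count-light {b ∷ bs} (o ∷ os) (_ ∷ nes) (p ∷ ps) (q ∷ qs) = step (mediums p)
    where
    sc : Carrier
    sc = ∑ (scrap ∘ sizeOf) b
    before-mediums : 12 · load b ≤ 6 · S + sc → ∑ ten (b ∷ bs) ≤ ∑∑ (restOf true) (b ∷ bs) + 20 · S
    before-mediums loaded = linear (S ∷ ∑ ten bs ∷ ∑ (restOf true) b ∷ ∑∑ (restOf true) bs ∷ [])
      (10 ⊛ x₀ ⊕ x₁) (x₂ ⊕ x₃ ⊕ 20 ⊛ x₀) 0
      (⟨ ∅ ≲ x₂ ⟩ ∑-nonneg (restOf≥0 true) b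
        ⊞ ⟨ x₁ ≲ x₃ ⊕ 10 ⊛ x₀ ⟩ count-medium true os nes ps (All.map (overflow⇒medium b two-thirds) o)) ≡.refl
      where
      two-thirds : 3 · load b ≤ 2 · S
      two-thirds = linear (S ∷ load b ∷ sc ∷ []) (3 ⊛ x₁) (2 ⊛ x₀) 3
        (⟨ 12 ⊛ x₁ ≲ 6 ⊛ x₀ ⊕ x₂ ⟩ loaded ⊞ ⟨ x₂ ≲ 2 ⊛ x₀ ⟩ q) ≡.refl
    step : 12 · load b ≤ sc ⊎ (12 · load b ≤ 6 · S + sc × 5 · S ≤ ∑ (restOf true) b) ⊎ 10 · S ≤ ∑ (restOf true) b →
           ∑ ten (b ∷ bs) ≤ ∑∑ (restOf true) (b ∷ bs) + 20 · S
    step (inj₁ loaded)              = before-mediums (≤-trans loaded (x≤y+x (0≤n·a 0≤S 6)))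
    step (inj₂ (inj₁ (loaded , _))) = before-mediums loaded
    step (inj₂ (inj₂ heavy))        = linear (S ∷ ∑ ten bs ∷ ∑ (restOf true) b ∷ ∑∑ (restOf true) bs ∷ [])
      (10 ⊛ x₀ ⊕ x₁) (x₂ ⊕ x₃ ⊕ 20 ⊛ x₀) 0
      (⟨ 10 ⊛ x₀ ≲ x₂ ⟩ heavy ⊞ ⟨ x₁ ≲ x₃ ⊕ 20 ⊛ x₀ ⟩ count-light os nes ps qs) ≡.refl

  -- Bins with a large item, one instance later

  Grown : Bin → Bin → Set
  Grown b b′ = ∃[ vs ] b′ ≡ vs ++ b

  ∑fill≥0 : ∀ b → 0# ≤ ∑fill b
  ∑fill≥0 = ∑-nonneg (λ i → fill≥0 (0≤D i) (sizeOf i))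

  grown-∑fill : ∀ {b b′} → Grown b b′ → ∑fill b ≤ ∑fill b′
  grown-∑fill {b} (vs , ≡.refl) = ≤-trans (x≤y+x (∑fill≥0 vs)) (≤-reflexive (≈-sym (∑-++ _ vs b)))

  -- The items of a light class weigh only half S or nothing; coarse adds the
  -- negligible weight of its scrap.
  coarse : Bool → Bool → Item → Carrier
  coarse false filled i = weightOf false filled i
  coarse true  filled i = weightOf true filled i + scrap (sizeOf i)

  weightOf≤coarse : ∀ light filled i → weightOf light filled i ≤ coarse light filled i
  weightOf≤coarse false filled i = ≤-refl
  weightOf≤coarse true  filled i = x≤x+y (scrap≥0 (0≤D i) (sizeOf i))

  coarse≥0 : ∀ light filled i → 0# ≤ coarse light filled i
  coarse≥0 light filled i = ≤-trans (weight≥0 (0≤D i) light filled (sizeOf i)) (weightOf≤coarse light filled i)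

  -- In a light class a medium item alone gives `5 · S`; if there is none, `scrap` covers every
  -- `fill`.
  ∑fill≤coarse : ∀ light filled b → 2 · load b ≤ S → ∑fill b ≤ ∑ (coarse light filled) b ⊎ 5 · S ≤ ∑ (coarse light filled) b
  ∑fill≤coarse false filled b _ = inj₁ (∑-mono (λ i → fill≤weight (0≤D i) filled (sizeOf i)) b)
  ∑fill≤coarse true  filled b p with any? (λ i → ¬? (3 · D i ≤? S)) b
  ... | yes some with find some
  ... | i , i∈b , m = inj₂ (≤-trans (5S≤half m (All.lookup (light⇒noneLarge b p) i∈b) (sizeOf i))
    (≤-trans (x≤y+x (top≥0 (0≤D i) filled (sizeOf i)))
      (≤-trans (weightOf≤coarse true filled i) (∈⇒≤∑ (coarse≥0 true filled) i∈b))))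
  ∑fill≤coarse true filled b p | no none = inj₁ (∑-mono-All (All.map
    (λ {i} q → ≤-trans (fill≤scrap (λ m → ⊥-elim (q m)) (sizeOf i)) (x≤y+x (weight≥0 (0≤D i) true filled (sizeOf i))))
    (¬Any⇒All¬ b none)))

  -- The weight of `b` plus the `fill` added to it later amounts to `10 · S`. In a filled class
  -- `12 · D x` and `∑fill b′` together reach `8 · S`, which makes up for the lowered `top`, while
  -- the items beside `x` pay for `∑fill b`. If one of those is medium in a light class, its `5 · S`
  -- completes `top` without any growth.
  large-bin : ∀ light filled {b b′ x} → LargeSplit b x → Grown b b′ → LargeSplit b′ x →
              (filled ≡ true → 2 · S ≤ 3 · load b′) →
              10 · S + ∑fill b ≤ ∑ (coarse light filled) b + ∑fill b′
  large-bin light filled {b} {b′} {x} sp grown sp′ full = step (∑fill≤coarse light filled ys sp.2others≤S)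
    where
    module sp = LargeSplit sp
    module sp′ = LargeSplit sp′
    ys ys′ : Bin
    ys  = sp.others
    ys′ = sp′.others
    C : Item → Carrier
    C = coarse light filled
    t : Carrier
    t = top filled (sizeOf x)
    Fb≤Fys : ∑fill b ≤ ∑fill ys
    Fb≤Fys = ≤-trans (≤-reflexive (sp.split _))
      (≤-trans (+-mono-≤ (fill≤0 sp.isLarge (sizeOf x)) ≤-refl) (≤-reflexive (+-identityˡ _)))
    t+C≤C : t + ∑ C ys ≤ ∑ C b
    t+C≤C = ≤-trans
      (+-mono-≤ (≤-trans (x≤x+y (rest≥0 (0≤D x) light (sizeOf x))) (weightOf≤coarse light filled x)) ≤-refl)
      (≤-reflexive (≈-sym (sp.split C)))
    12load≤12x+F : 12 · load b′ ≤ 12 · D x + ∑fill b′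
    12load≤12x+F = linear (load b′ ∷ D x ∷ load ys′ ∷ ∑fill ys′ ∷ ∑fill b′ ∷ fill (sizeOf x) ∷ []) (12 ⊛ x₀) (12 ⊛ x₁ ⊕ x₄) 0
      (12 ⊠ ⟨ x₀ ≲ x₁ ⊕ x₂ ⟩ ≤-reflexive (sp′.split D)
        ⊞ ⟨ 12 ⊛ x₂ ≲ x₃ ⟩ ≤-reflexive (≈-sym (∑fill-nonLarge (light⇒noneLarge ys′ sp′.2others≤S)))
        ⊞ ⟨ x₅ ⊕ x₃ ≲ x₄ ⟩ ≤-reflexive (≈-sym (sp′.split _))
        ⊞ ⟨ ∅ ≲ x₅ ⟩ fill≥0 (0≤D x) (sizeOf x)) ≡.refl
    8S≤12x+F : filled ≡ true → 8 · S ≤ 12 · D x + ∑fill b′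
    8S≤12x+F eq = linear (S ∷ D x ∷ load b′ ∷ ∑fill b′ ∷ []) (8 ⊛ x₀) (12 ⊛ x₁ ⊕ x₃) 0
      (4 ⊠ ⟨ 2 ⊛ x₀ ≲ 3 ⊛ x₂ ⟩ full eq ⊞ ⟨ 12 ⊛ x₂ ≲ 12 ⊛ x₁ ⊕ x₃ ⟩ 12load≤12x+F) ≡.refl
    step : ∑fill ys ≤ ∑ C ys ⊎ 5 · S ≤ ∑ C ys → 10 · S + ∑fill b ≤ ∑ C b + ∑fill b′
    step (inj₁ q) = linear (S ∷ ∑fill b ∷ ∑fill b′ ∷ ∑fill ys ∷ t ∷ ∑ C ys ∷ ∑ C b ∷ []) (10 ⊛ x₀ ⊕ x₁) (x₆ ⊕ x₂) 0
      (⟨ 10 ⊛ x₀ ≲ x₄ ⊕ x₂ ⟩ 10S≤top+ filled (∑fill≥0 b′) 8S≤12x+F sp.isLarge (sizeOf x)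
        ⊞ ⟨ x₁ ≲ x₃ ⟩ Fb≤Fys ⊞ ⟨ x₃ ≲ x₅ ⟩ q ⊞ ⟨ x₄ ⊕ x₅ ≲ x₆ ⟩ t+C≤C) ≡.refl
    step (inj₂ q) = linear (S ∷ ∑fill b ∷ ∑fill b′ ∷ t ∷ ∑ C ys ∷ ∑ C b ∷ []) (10 ⊛ x₀ ⊕ x₁) (x₅ ⊕ x₂) 0
      (⟨ 10 ⊛ x₀ ≲ x₃ ⊕ 5 ⊛ x₀ ⟩ 10S≤top+5S filled sp.isLarge (sizeOf x)
        ⊞ ⟨ 5 ⊛ x₀ ≲ x₄ ⟩ q ⊞ ⟨ x₁ ≲ x₂ ⟩ grown-∑fill grown ⊞ ⟨ x₃ ⊕ x₄ ≲ x₅ ⟩ t+C≤C) ≡.refl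

  -- Counting the bins of a class

  Capacity : Bin → Set ℓ₂
  Capacity b = load b ≤ S

  record FirstFit (bs : List Bin) : Set ℓ₂ where
    field
      overflows : AllPairs _Overflows_ bs
      nonEmpty  : All NonEmpty bs
      capacity  : All Capacity bs

  smallOnly? : ∀ b → Dec (¬ Any Large b)
  smallOnly? b = ¬? (any? large? b)

  exceptional : List Bin → List Bin
  exceptional = filter smallOnly?

  -- Sums `large-bin` over the bins with a large item. To avoid subtraction, the remaining bins are
  -- removed by adding their weight on the left and their number on the right.
  count-pairs : ∀ light filled {bs bs′} → Pointwise Grown bs bs′ → All Capacity bs → All Capacity bs′ →
    (filled ≡ true → All (λ b′ → Any Large b′ → 2 · S ≤ 3 · load b′) bs′) →
    ∑ ten bs + ∑ ∑fill bs + ∑∑ (coarse light filled) (exceptional bs)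
      ≤ ∑∑ (coarse light filled) bs + ∑ ∑fill bs′ + ∑ ten (exceptional bs)
  count-pairs light filled [] _ _ _ = ≤-refl
  count-pairs light filled {b ∷ bs} {b′ ∷ bs′} (g ∷ gs) (cap ∷ caps) (cap′ ∷ caps′) full
    with any? large? b | count-pairs light filled gs caps caps′ (λ eq → All.tail (full eq))
  ... | no _ | ih = linear
    (10 · S ∷ ∑ ten bs ∷ ∑fill b ∷ ∑ ∑fill bs ∷ ∑ C b ∷ ∑∑ C (exceptional bs) ∷ ∑∑ C bs ∷ ∑fill b′ ∷ ∑ ∑fill bs′ ∷ ∑ ten (exceptional bs) ∷ [])
    (x₀ ⊕ x₁ ⊕ (x₂ ⊕ x₃) ⊕ (x₄ ⊕ x₅)) (x₄ ⊕ x₆ ⊕ (x₇ ⊕ x₈) ⊕ (x₀ ⊕ x₉)) 0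
    (⟨ x₂ ≲ x₇ ⟩ grown-∑fill g ⊞ ⟨ x₁ ⊕ x₃ ⊕ x₅ ≲ x₆ ⊕ x₈ ⊕ x₉ ⟩ ih) ≡.refl
    where
    C : Item → Carrier
    C = coarse light filled
  ... | yes some | ih with find some
  ... | x , x∈b , lx = linear
    (10 · S ∷ ∑ ten bs ∷ ∑fill b ∷ ∑ ∑fill bs ∷ ∑ C b ∷ ∑∑ C (exceptional bs) ∷ ∑∑ C bs ∷ ∑fill b′ ∷ ∑ ∑fill bs′ ∷ ∑ ten (exceptional bs) ∷ [])
    (x₀ ⊕ x₁ ⊕ (x₂ ⊕ x₃) ⊕ x₅) (x₄ ⊕ x₆ ⊕ (x₇ ⊕ x₈) ⊕ x₉) 0
    (⟨ x₀ ⊕ x₂ ≲ x₄ ⊕ x₇ ⟩ large-bin light filled (largeSplit cap lx x∈b) g (largeSplit cap′ lx x∈b′)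
        (λ eq → All.head (full eq) (lose x∈b′ lx))
      ⊞ ⟨ x₁ ⊕ x₃ ⊕ x₅ ≲ x₆ ⊕ x₈ ⊕ x₉ ⟩ ih) ≡.refl
    where
    C : Item → Carrier
    C = coarse light filled
    x∈b′ : x ∈ b′
    x∈b′ = ≡.subst (x ∈_) (≡.sym (proj₂ g)) (∈-++⁺ʳ (proj₁ g) x∈b)

  restOf≤coarse : ∀ light filled i → restOf light i ≤ coarse light filled i
  restOf≤coarse light filled i = ≤-trans (x≤y+x (top≥0 (0≤D i) filled (sizeOf i))) (weightOf≤coarse light filled i)

  exceptional-nonLarge : ∀ bs → All (All NonLarge) (exceptional bs)
  exceptional-nonLarge bs = All.map noneLarge (all-filter smallOnly? bs)

  -- An ordinary class loses three bins. A light one loses only two, which leaves room for the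
  -- `2 · S` by which `coarse` overstates its weight.
  count-exceptional : ∀ light filled {bs} → FirstFit bs →
    (light ≡ true → All (λ b → ∑ (scrap ∘ sizeOf) b ≤ 2 · S) bs) →
    ∑ ten (exceptional bs) + gate light (2 · S) ≤ ∑∑ (coarse light filled) (exceptional bs) + 30 · S
  count-exceptional true filled {bs} ff scraps = linear (∑ ten E ∷ S ∷ ∑∑ (restOf true) E ∷ ∑∑ (coarse true filled) E ∷ [])
    (x₀ ⊕ 2 ⊛ x₁) (x₃ ⊕ 30 ⊛ x₁) 0
    (⟨ x₀ ≲ x₂ ⊕ 20 ⊛ x₁ ⟩ count-light (AllPairs.filter⁺ smallOnly? overflows) (All.filter⁺ smallOnly? nonEmpty)
        (exceptional-nonLarge bs) (All.filter⁺ smallOnly? (scraps ≡.refl))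
      ⊞ ⟨ x₂ ≲ x₃ ⟩ ∑-mono (∑-mono (restOf≤coarse true filled)) E ⊞ 8 ⊠ ⟨ ∅ ≲ x₁ ⟩ 0≤S) ≡.refl
    where
    open FirstFit ff
    E : List Bin
    E = exceptional bs
  count-exceptional false filled {bs} ff _ = ≤-trans (≤-reflexive (+-identityʳ _))
    (chain (AllPairs.filter⁺ smallOnly? overflows) (All.filter⁺ smallOnly? nonEmpty) (exceptional-nonLarge bs))
    where
    open FirstFit ff
    chain : ∀ {bs} → AllPairs _Overflows_ bs → All NonEmpty bs → All (All NonLarge) bs →
            ∑ ten bs ≤ ∑∑ (coarse false filled) bs + 30 · S
    chain [] _ _ = ≤-trans (0≤n·a 0≤S 30) (x≤y+x ≤-refl)
    chain {b ∷ bs} os (_ ∷ nes) (p ∷ ps) = ≤-trans (count-chain os nes (p ∷ ps))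
      (+-mono-≤ (+-mono-≤ (≤-trans (≤-reflexive (≈-sym (∑fill-nonLarge p)))
          (∑-mono (λ i → fill≤weight (0≤D i) filled (sizeOf i)) b))
        (∑-mono (∑-mono (restOf≤coarse false filled)) bs)) ≤-refl)

  -- The bins bs are First-Fit on the items is; bs′ are the same bins one
  -- instance later.
  count-class : ∀ light filled is {bs bs′} → FirstFit bs → (∀ g → ∑∑ g bs ≈ ∑ g is) →
    Pointwise Grown bs bs′ → All Capacity bs′ →
    (filled ≡ true → All (λ b′ → Any Large b′ → 2 · S ≤ 3 · load b′) bs′) →
    (light ≡ true → ∑ (scrap ∘ sizeOf) is ≤ 2 · S) →
    ∑ ten bs + ∑ ∑fill bs ≤ ∑ (weightOf light filled) is + ∑ ∑fill bs′ + 30 · S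
  count-class light filled is {bs} {bs′} ff conserve grown capacity′ full scraps = linear
    (∑ ten bs ∷ ∑ ∑fill bs ∷ ∑∑ C E ∷ ∑∑ C bs ∷ ∑ ∑fill bs′ ∷ ∑ ten E ∷ gate light (2 · S) ∷ ∑ C is ∷ ∑ (weightOf light filled) is ∷ S ∷ [])
    (x₀ ⊕ x₁) (x₈ ⊕ x₄ ⊕ 30 ⊛ x₉) 0
    (⟨ x₀ ⊕ x₁ ⊕ x₂ ≲ x₃ ⊕ x₄ ⊕ x₅ ⟩ count-pairs light filled grown (FirstFit.capacity ff) capacity′ full
      ⊞ ⟨ x₅ ⊕ x₆ ≲ x₂ ⊕ 30 ⊛ x₉ ⟩ count-exceptional light filled ff bin-scraps
      ⊞ ⟨ x₃ ≲ x₇ ⟩ ≤-reflexive (conserve C)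
      ⊞ ⟨ x₇ ≲ x₈ ⊕ x₆ ⟩ coarse≤ light scraps) ≡.refl
    where
    E : List Bin
    E = exceptional bs
    C : Item → Carrier
    C = coarse light filled
    bin-scraps : light ≡ true → All (λ b → ∑ (scrap ∘ sizeOf) b ≤ 2 · S) bs
    bin-scraps eq = All.tabulate λ b∈bs → ≤-trans
      (∈⇒≤∑ (∑-nonneg (λ i → scrap≥0 (0≤D i) (sizeOf i))) b∈bs)
      (≤-trans (≤-reflexive (conserve _)) (scraps eq))
    coarse≤ : ∀ light → (light ≡ true → ∑ (scrap ∘ sizeOf) is ≤ 2 · S) →
              ∑ (coarse light filled) is ≤ ∑ (weightOf light filled) is + gate light (2 · S)
    coarse≤ false _      = ≤-reflexive (≈-sym (+-identityʳ _))
    coarse≤ true  scraps = ≤-trans (≤-reflexive (∑-+ _ _ is)) (+-monoʳ-≤ _ (scraps ≡.refl))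

  -- Runs of First-Fit over a block of bins

  data Step (i : Item) : List Bin → List Bin → Set ℓ₂ where
    here  : ∀ {b bs} → Fits i b → Step i (b ∷ bs) ((i ∷ b) ∷ bs)
    there : ∀ {b bs bs′} → ¬ Fits i b → Step i bs bs′ → Step i (b ∷ bs) (b ∷ bs′)

  step? : ∀ i bs → (∃[ bs′ ] Step i bs bs′) ⊎ All (¬_ ∘ Fits i) bs
  step? i [] = inj₂ []
  step? i (b ∷ bs) with fits? i b | step? i bs
  ... | yes fits | _                = inj₁ (_ , here fits)
  ... | no ¬fits | inj₁ (bs′ , s)   = inj₁ (_ , there ¬fits s)
  ... | no ¬fits | inj₂ none        = inj₂ (¬fits ∷ none)

  place-step : ∀ {i bs bs′} → Step i bs bs′ → ∀ cs → place (bs ++ cs) i ≡ bs′ ++ cs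
  place-step {i} (here {b} fits) cs with fits? i b
  ... | yes _    = ≡.refl
  ... | no ¬fits = ⊥-elim (¬fits fits)
  place-step {i} (there {b} ¬fits s) cs with fits? i b
  ... | yes fits = ⊥-elim (¬fits fits)
  ... | no _     = ≡.cong (b ∷_) (place-step s cs)

  place-none : ∀ {i bs} → All (¬_ ∘ Fits i) bs → ∀ cs → place (bs ++ cs) i ≡ bs ++ place cs i
  place-none [] cs = ≡.refl
  place-none {i} {b ∷ bs} (¬fits ∷ none) cs with fits? i b
  ... | yes fits = ⊥-elim (¬fits fits)
  ... | no _     = ≡.cong (b ∷_) (place-none none cs)

  step-All : ∀ {p} {P : Bin → Set p} {i} → (∀ {b} → Fits i b → P b → P (i ∷ b)) →
             ∀ {bs bs′} → Step i bs bs′ → All P bs → All P bs′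
  step-All grow (here fits) (p ∷ ps) = grow fits p ∷ ps
  step-All grow (there _ s) (p ∷ ps) = p ∷ step-All grow s ps

  step-∑∑ : ∀ g {i bs bs′} → Step i bs bs′ → ∑∑ g bs′ ≈ g i + ∑∑ g bs
  step-∑∑ g (here _)    = +-assoc _ _ _
  step-∑∑ g (there _ s) = ≈-trans (+-cong ≈-refl (step-∑∑ g s)) (x∙yz≈y∙xz _ _ _)

  step-ten : ∀ {i bs bs′} → Step i bs bs′ → ∑ ten bs′ ≡ ∑ ten bs
  step-ten (here _)    = ≡.refl
  step-ten (there _ s) = ≡.cong (λ x → 10 · S + x) (step-ten s)

  step-grown : ∀ {i bs bs′ bs₀} → Step i bs bs′ → Pointwise Grown bs₀ bs → Pointwise Grown bs₀ bs′
  step-grown {i} (here _) ((vs , ≡.refl) ∷ gs) = (i ∷ vs , ≡.refl) ∷ gs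
  step-grown (there _ s) (g ∷ gs)              = g ∷ step-grown s gs

  grown-refl : ∀ bs → Pointwise Grown bs bs
  grown-refl bs = Pointwise.refl ([] , ≡.refl)

  data Run : List Bin → List Item → List Bin → List Item → Set ℓ₂ where
    done   : ∀ {bs} → Run bs [] bs []
    accept : ∀ {bs bs′ bs″ i is rs} → Step i bs bs′ → Run bs′ is bs″ rs → Run bs (i ∷ is) bs″ rs
    reject : ∀ {bs bs′ i is rs} → All (¬_ ∘ Fits i) bs → Run bs is bs′ rs → Run bs (i ∷ is) bs′ (i ∷ rs)

  run : ∀ bs is → ∃₂ (Run bs is)
  run bs [] = bs , [] , done
  run bs (i ∷ is) with step? i bs
  ... | inj₁ (bs′ , s) = let bs″ , rs , ρ = run bs′ is in bs″ , rs , accept s ρ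
  ... | inj₂ none      = let bs″ , rs , ρ = run bs is in bs″ , i ∷ rs , reject none ρ

  -- Accepted items never reach `cs`, and rejected ones leave `bs` unchanged. An instance may
  -- therefore be run over the block `bs` first and its rejected items over the bins behind it
  -- afterwards, which is what separates the classes.
  foldl-run : ∀ {bs is bs′ rs} → Run bs is bs′ rs → ∀ cs → foldl place (bs ++ cs) is ≡ bs′ ++ foldl place cs rs
  foldl-run done cs = ≡.refl
  foldl-run (accept {is = is} s ρ) cs =
    ≡.trans (≡.cong (λ bs → foldl place bs is) (place-step s cs)) (foldl-run ρ cs)
  foldl-run (reject {i = i} {is = is} none ρ) cs =
    ≡.trans (≡.cong (λ bs → foldl place bs is) (place-none none cs)) (foldl-run ρ (place cs i))

  run-All : ∀ {p} {P : Bin → Set p} → (∀ {i b} → Fits i b → P b → P (i ∷ b)) →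
            ∀ {bs is bs′ rs} → Run bs is bs′ rs → All P bs → All P bs′
  run-All grow done         ps = ps
  run-All grow (accept s ρ) ps = run-All grow ρ (step-All grow s ps)
  run-All grow (reject _ ρ) ps = run-All grow ρ ps

  run-capacity : ∀ {bs is bs′ rs} → Run bs is bs′ rs → All Capacity bs → All Capacity bs′
  run-capacity = run-All λ fits _ → proj₁ fits

  run-ten : ∀ {bs is bs′ rs} → Run bs is bs′ rs → ∑ ten bs′ ≡ ∑ ten bs
  run-ten done         = ≡.refl
  run-ten (accept s ρ) = ≡.trans (run-ten ρ) (step-ten s)
  run-ten (reject _ ρ) = run-ten ρ

  run-grown : ∀ {bs is bs′ rs bs₀} → Run bs is bs′ rs → Pointwise Grown bs₀ bs → Pointwise Grown bs₀ bs′
  run-grown done         gs = gs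
  run-grown (accept s ρ) gs = run-grown ρ (step-grown s gs)
  run-grown (reject _ ρ) gs = run-grown ρ gs

  run-rejects : ∀ {p} {P : Item → Set p} {bs is bs′ rs} → Run bs is bs′ rs → All P is → All P rs
  run-rejects done         []       = []
  run-rejects (accept _ ρ) (_ ∷ ps) = run-rejects ρ ps
  run-rejects (reject _ ρ) (p ∷ ps) = p ∷ run-rejects ρ ps

  run-unique : ∀ {bs is bs′ rs} → Run bs is bs′ rs → Unique is → Unique rs
  run-unique done         []       = []
  run-unique (accept _ ρ) (_ ∷ us) = run-unique ρ us
  run-unique (reject _ ρ) (u ∷ us) = run-rejects ρ u ∷ run-unique ρ us

  unfit-grows : ∀ {i j b} → ¬ Fits i b → ¬ Fits i (j ∷ b)
  unfit-grows {i} {j} {b} ¬fits (cap , i∉) = ¬fits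
    ( ≤-trans (+-monoʳ-≤ (D i) (x≤y+x (0≤D j))) cap , i∉ ∘ there )

  run-unfit : ∀ {bs is bs′ rs} → Run bs is bs′ rs → All (λ y → All (¬_ ∘ Fits y) bs′) rs
  run-unfit done            = []
  run-unfit (accept _ ρ)    = run-unfit ρ
  run-unfit (reject none ρ) = run-All (λ _ → unfit-grows) ρ none ∷ run-unfit ρ

  -- An accepted item leaves the list with `u` and enters a bin with at most as much. With `f` the
  -- `fill`, an instance thereby pays for what it adds to the previous class.
  run-∑ : ∀ {f u : Item → Carrier} → (∀ i → f i ≤ u i) → ∀ {bs is bs′ rs} → Run bs is bs′ rs →
          ∑∑ f bs′ + ∑ u rs ≤ ∑∑ f bs + ∑ u is
  run-∑ f≤u done = ≤-refl
  run-∑ {f} {u} f≤u (accept {bs} {bs′} {bs″} {i} {is} {rs} s ρ) = linear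
    (∑∑ f bs″ ∷ ∑ u rs ∷ ∑∑ f bs′ ∷ ∑ u is ∷ f i ∷ u i ∷ ∑∑ f bs ∷ []) (x₀ ⊕ x₁) (x₆ ⊕ (x₅ ⊕ x₃)) 0
    (⟨ x₀ ⊕ x₁ ≲ x₂ ⊕ x₃ ⟩ run-∑ f≤u ρ ⊞ ⟨ x₂ ≲ x₄ ⊕ x₆ ⟩ ≤-reflexive (step-∑∑ f s) ⊞ ⟨ x₄ ≲ x₅ ⟩ f≤u i) ≡.refl
  run-∑ {f} {u} f≤u (reject {bs} {bs′} {i} {is} {rs} none ρ) = linear
    (∑∑ f bs′ ∷ ∑ u rs ∷ ∑∑ f bs ∷ ∑ u is ∷ u i ∷ []) (x₀ ⊕ (x₄ ⊕ x₁)) (x₂ ⊕ (x₄ ⊕ x₃)) 0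
    (⟨ x₀ ⊕ x₁ ≲ x₂ ⊕ x₃ ⟩ run-∑ f≤u ρ) ≡.refl

  run-∑-rejected : ∀ {u : Item → Carrier} → (∀ i → 0# ≤ u i) → ∀ {bs is bs′ rs} → Run bs is bs′ rs →
                   ∑ u rs ≤ ∑ u is
  run-∑-rejected u≥0 done = ≤-refl
  run-∑-rejected u≥0 (accept _ ρ) = ≤-trans (run-∑-rejected u≥0 ρ) (x≤y+x (u≥0 _))
  run-∑-rejected u≥0 (reject _ ρ) = +-monoʳ-≤ _ (run-∑-rejected u≥0 ρ)

  -- First-Fit on the items of one class

  overflow-grows : ∀ {i} b {b′} → b Overflows b′ → (i ∷ b) Overflows b′
  overflow-grows {i} b = All.map λ {j} o cap → o (≤-trans (+-monoʳ-≤ (D j) (x≤y+x (0≤D i))) cap)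

  step-overflows : ∀ {i bs bs′} → All (i ∉_) bs → Step i bs bs′ → AllPairs _Overflows_ bs → AllPairs _Overflows_ bs′
  step-overflows _ (here {b} _) (o ∷ os) = All.map (overflow-grows b) o ∷ os
  step-overflows (i∉b ∷ i∉bs) (there ¬fits s) (o ∷ os) =
    step-All (λ _ o → (λ cap → ¬fits (cap , i∉b)) ∷ o) s o ∷ step-overflows i∉bs s os

  -- As no bin contains `i`, not fitting means exceeding the capacity, so every bin that was passed
  -- over overflows with `i`.
  place-firstFit : ∀ {i bs} → All (i ∉_) bs → FirstFit bs → FirstFit (place bs i)
  place-firstFit {i} {bs} i∉bs ff with step? i bs
  ... | inj₁ (bs′ , s) = ≡.subst FirstFit
    (≡.sym (≡.trans (≡.cong (λ bs → place bs i) (≡.sym (++-identityʳ bs))) (≡.trans (place-step s []) (++-identityʳ bs′))))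
    (record
      { overflows = step-overflows i∉bs s overflows
      ; nonEmpty  = step-All (λ _ _ ()) s nonEmpty
      ; capacity  = step-All (λ fits _ → proj₁ fits) s capacity })
    where open FirstFit ff
  ... | inj₂ none = ≡.subst FirstFit
    (≡.sym (≡.trans (≡.cong (λ bs → place bs i) (≡.sym (++-identityʳ bs))) (place-none none [])))
    (record
      { overflows = AllPairs.++⁺ overflows ([] ∷ []) (All.zipWith
          (λ (¬fits , i∉b) → ((λ cap → ¬fits (cap , i∉b)) ∷ []) ∷ []) (none , i∉bs))
      ; nonEmpty  = All.++⁺ nonEmpty ((λ ()) ∷ [])
      ; capacity  = All.++⁺ capacity (≤-trans (≤-reflexive (+-identityʳ (D i))) (D≤S i) ∷ []) })
    where open FirstFit ff

  place-∉ : ∀ {i j} → j ≢ i → ∀ {bs} → All (j ∉_) bs → All (j ∉_) (place bs i)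
  place-∉ j≢i {[]} [] = (λ where (here j≡i) → j≢i j≡i) ∷ []
  place-∉ {i} j≢i {b ∷ bs} (p ∷ ps) with fits? i b
  ... | yes _ = (λ where
          (here j≡i)  → j≢i j≡i
          (there j∈b) → p j∈b) ∷ ps
  ... | no _  = p ∷ place-∉ j≢i ps

  place-∑∑ : ∀ g bs i → ∑∑ g (place bs i) ≈ ∑∑ g bs + g i
  place-∑∑ g [] i = ≈-trans (+-identityʳ _) (+-comm _ _)
  place-∑∑ g (b ∷ bs) i with fits? i b
  ... | yes _ = ≈-trans (+-assoc _ _ _) (+-comm _ _)
  ... | no _  = ≈-trans (+-cong ≈-refl (place-∑∑ g bs i)) (≈-sym (+-assoc _ _ _))

  foldl-firstFit : ∀ {bs is} → Unique is → All (λ i → All (i ∉_) bs) is → FirstFit bs → FirstFit (foldl place bs is)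
  foldl-firstFit []       []       ff = ff
  foldl-firstFit (u ∷ us) (p ∷ ps) ff = foldl-firstFit us
    (All.zipWith (λ (i≢j , j∉bs) → place-∉ (i≢j ∘ ≡.sym) j∉bs) (u , ps)) (place-firstFit p ff)

  foldl-∑∑ : ∀ g bs is → ∑∑ g (foldl place bs is) ≈ ∑∑ g bs + ∑ g is
  foldl-∑∑ g bs []       = ≈-sym (+-identityʳ _)
  foldl-∑∑ g bs (i ∷ is) = ≈-trans (foldl-∑∑ g (place bs i) is)
    (≈-trans (+-cong (place-∑∑ g bs i) ≈-refl) (+-assoc _ _ _))

  firstFit : List Item → List Bin
  firstFit = foldl place []

  firstFit-firstFit : ∀ {is} → Unique is → FirstFit (firstFit is)
  firstFit-firstFit us = foldl-firstFit us (All.universal (λ _ → []) _)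
    (record { overflows = [] ; nonEmpty = [] ; capacity = [] })

  firstFit-∑∑ : ∀ is g → ∑∑ g (firstFit is) ≈ ∑ g is
  firstFit-∑∑ is g = ≈-trans (foldl-∑∑ g [] is) (+-identityˡ _)

  -- Filled and light classes

  Filled : Bin → Set ℓ₂
  Filled b = Any Large b → 2 · S ≤ 3 · load b

  filled? : ∀ b → Dec (Filled b)
  filled? b = any? large? b →-dec (2 · S ≤? 3 · load b)

  Scrap : Item → Set ℓ₂
  Scrap i = 3 · D i ≤ S

  scrap? : ∀ i → Dec (Scrap i)
  scrap? i = 3 · D i ≤? S

  ∑scrap≤12load : ∀ is → ∑ (scrap ∘ sizeOf) is ≤ 12 · load (filter scrap? is)
  ∑scrap≤12load []       = ≤-reflexive (≈-sym (·-zeroʳ 12))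
  ∑scrap≤12load (i ∷ is) = step (scrap? i)
    where
    ys : List Item
    ys = filter scrap? is
    step : Dec (Scrap i) → ∑ (scrap ∘ sizeOf) (i ∷ is) ≤ 12 · load (filter scrap? (i ∷ is))
    step (yes s) = ≡.subst (λ zs → ∑ (scrap ∘ sizeOf) (i ∷ is) ≤ 12 · load zs) (≡.sym (filter-accept scrap? s))
      (linear (scrap (sizeOf i) ∷ ∑ (scrap ∘ sizeOf) is ∷ D i ∷ load ys ∷ []) (x₀ ⊕ x₁) (12 ⊛ (x₂ ⊕ x₃)) 0
        (⟨ x₀ ≲ 12 ⊛ x₂ ⟩ scrap≤12a (0≤D i) (sizeOf i) ⊞ ⟨ x₁ ≲ 12 ⊛ x₃ ⟩ ∑scrap≤12load is) ≡.refl)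
    step (no ¬s) = ≡.subst (λ zs → ∑ (scrap ∘ sizeOf) (i ∷ is) ≤ 12 · load zs) (≡.sym (filter-reject scrap? ¬s))
      (≤-trans (+-mono-≤ (scrap≤0 ¬s (sizeOf i)) (∑scrap≤12load is)) (≤-reflexive (+-identityˡ _)))

  -- There is room in `b` for any item up to 1/3, so such an item is rejected only because of its
  -- copy in `b`. All scraps of `is` thus lie in `b` beside `x`, within 2/3 - 1/2 = 1/6 of the
  -- capacity, that is `2 · S` at rate 12.
  unfit-scraps : ∀ {b x is} → x ∈ b → Large x → ¬ 2 · S ≤ 3 · load b → Unique is →
                 All (λ y → ¬ Fits y b) is → ∑ (scrap ∘ sizeOf) is ≤ 2 · S
  unfit-scraps {b} {x} {is} x∈b lx ¬full us unfit = linear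
    (∑ (scrap ∘ sizeOf) is ∷ load ys ∷ D x ∷ load b ∷ S ∷ []) x₀ (2 ⊛ x₄) 0
    (⟨ x₀ ≲ 12 ⊛ x₁ ⟩ ∑scrap≤12load is
      ⊞ 12 ⊠ ⟨ x₂ ⊕ x₁ ≲ x₃ ⟩ ∑-⊆ 0≤D (x≢ys ∷ Unique.filter⁺ scrap? us) x∷ys⊆b
      ⊞ 4 ⊠ ⟨ 3 ⊛ x₃ ≲ 2 ⊛ x₄ ⟩ ≰⇒≥ ¬full ⊞ 6 ⊠ ⟨ x₄ ≲ 2 ⊛ x₂ ⟩ ≰⇒≥ lx) ≡.refl
    where
    ys : List Item
    ys = filter scrap? is
    x≢ys : All (x ≢_) ys
    x≢ys = All.map (λ { s ≡.refl → lx (≤-trans (x≤y+x (0≤D x)) s) }) (all-filter scrap? is)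
    x∷ys⊆b : x ∷ ys ⊆ b
    x∷ys⊆b (here ≡.refl) = x∈b
    x∷ys⊆b {y} (there y∈ys) with ∈-filter⁻ scrap? y∈ys
    ... | y∈is , s = decidable-stable (_∈?_ _≟_ y b) λ y∉b → All.lookup unfit y∈is
      ( linear (D y ∷ load b ∷ S ∷ []) (x₀ ⊕ x₁) x₂ 2
          (⟨ 3 ⊛ x₀ ≲ x₂ ⟩ s ⊞ ⟨ 3 ⊛ x₁ ≲ 2 ⊛ x₂ ⟩ ≰⇒≥ ¬full) ≡.refl
      , y∉b )

  -- Induction over the instances

  all : List Item
  all = allFin n

  -- State after j + 1 instances: the bins opened in the last instance are
  -- First-Fit on newest, the others are old.  V is the total weight of the
  -- first j instances, and light says that some bin of the previous class
  -- stayed less than two-thirds full.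
  record Invariant (j : ℕ) (old : List Bin) (newest : List Item) : Set (c ⊔ ℓ₁ ⊔ ℓ₂) where
    field
      unique  : Unique newest
      light   : Bool
      V       : Item → Carrier
      V≥0     : ∀ i → 0# ≤ V i
      bounded : ∀ b → Capacity b → ∑ V b ≤ j · (15 · S) + gate light (Φ b)
      scraps  : light ≡ true → ∑ (scrap ∘ sizeOf) newest ≤ 2 · S
      -- The rest of the last instance may already be spent on filling old bins,
      -- but only at the rate of fill, and not at all if the class is light.
      paid    : ∀ u → (∀ i → 0# ≤ u i) → (light ≡ false → ∀ i → fill (sizeOf i) ≤ u i) →
                ∑ ten old + ∑ u newest ≤ ∑ V all + ∑ u all + j · (30 · S)

  record Outcome (j : ℕ) (bs : List Bin) : Set (c ⊔ ℓ₁ ⊔ ℓ₂) where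
    field
      V       : Item → Carrier
      V≥0     : ∀ i → 0# ≤ V i
      bounded : ∀ b → Capacity b → ∑ V b ≤ j · (15 · S) + 2 · S
      paid    : ∑ ten bs ≤ ∑ V all + j · (30 · S)

  module _ {j old newest} (inv : Invariant j old newest) where
    open Invariant inv

    private
      newBins : List Bin
      newBins = firstFit newest

      -- Whether the newest class is filled is known only after the next instance, so its weight is
      -- fixed as late as here; this is why `paid` quantifies over `u`.
      module Spend (filled : Bool) where

        u V′ : Item → Carrier
        u = weightOf light filled
        V′ i = V i + u i

        u≥0 : ∀ i → 0# ≤ u i
        u≥0 i = weight≥0 (0≤D i) light filled (sizeOf i)

        V′≥0 : ∀ i → 0# ≤ V′ i
        V′≥0 i = +-nonneg (V≥0 i) (u≥0 i)

        bounded′ : ∀ b → Capacity b → ∑ V′ b ≤ suc j · (15 · S) + gate (not filled) (Φ b)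
        bounded′ b cap = linear
          (∑ V′ b ∷ ∑ V b ∷ ∑ u b ∷ j · (15 · S) ∷ gate light (Φ b) ∷ S ∷ gate (not filled) (Φ b) ∷ [])
          x₀ (15 ⊛ x₅ ⊕ x₃ ⊕ x₆) 0
          (⟨ x₀ ≲ x₁ ⊕ x₂ ⟩ ≤-reflexive (∑-+ V u b) ⊞ ⟨ x₁ ≲ x₃ ⊕ x₄ ⟩ bounded b cap
            ⊞ ⟨ x₂ ⊕ x₄ ≲ 15 ⊛ x₅ ⊕ x₆ ⟩ bin-weight light filled b cap) ≡.refl

        old-paid : ∑ ten old + ∑ u newest ≤ ∑ V′ all + j · (30 · S)
        old-paid = ≤-trans (paid u u≥0 rate) (+-mono-≤ (≤-reflexive (≈-sym (∑-+ V u all))) ≤-refl)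
          where
          rate : light ≡ false → ∀ i → fill (sizeOf i) ≤ u i
          rate eq i = ≡.subst (λ l → fill (sizeOf i) ≤ weight l filled (sizeOf i)) (≡.sym eq)
            (fill≤weight (0≤D i) filled (sizeOf i))

        all-paid : ∀ {bs′} → Pointwise Grown newBins bs′ → All Capacity bs′ →
          (filled ≡ true → All Filled bs′) →
          ∑ ten old + ∑ ten newBins + ∑ ∑fill newBins ≤ ∑ V′ all + suc j · (30 · S) + ∑ ∑fill bs′
        all-paid {bs′} grown cap full = linear
          (∑ ten old ∷ ∑ ten newBins ∷ ∑ ∑fill newBins ∷ ∑ V′ all ∷ S ∷ j · (30 · S) ∷ ∑ ∑fill bs′ ∷ ∑ u newest ∷ [])
          (x₀ ⊕ x₁ ⊕ x₂) (x₃ ⊕ (30 ⊛ x₄ ⊕ x₅) ⊕ x₆) 0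
          (⟨ x₀ ⊕ x₇ ≲ x₃ ⊕ x₅ ⟩ old-paid
            ⊞ ⟨ x₁ ⊕ x₂ ≲ x₇ ⊕ x₆ ⊕ 30 ⊛ x₄ ⟩ count-class light filled newest (firstFit-firstFit unique)
                (firstFit-∑∑ newest) grown cap full scraps) ≡.refl

      newBins-capacity : All Capacity newBins
      newBins-capacity = FirstFit.capacity (firstFit-firstFit unique)

      -- Here `top` is not lowered, so the bins can be compared with themselves: `∑fill` cancels and
      -- the next instance keeps its whole weight.
      unfilled-paid : let open Spend false in ∑ ten old + ∑ ten newBins ≤ ∑ V′ all + suc j · (30 · S)
      unfilled-paid = linear (∑ ten old ∷ ∑ ten newBins ∷ ∑ ∑fill newBins ∷ ∑ V′ all ∷ suc j · (30 · S) ∷ [])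
        (x₀ ⊕ x₁) (x₃ ⊕ x₄) 0
        (⟨ x₀ ⊕ x₁ ⊕ x₂ ≲ x₃ ⊕ x₄ ⊕ x₂ ⟩ all-paid (grown-refl newBins) newBins-capacity (λ ())) ≡.refl
        where open Spend false

    -- No instance follows, so the last class is weighed as unfilled. The excess left in an optimal
    -- bin is at most `2 · S`, which yields the term 1/(5k) on division by `10 · k` times `S`.
    finish : Outcome (suc j) (old ++ newBins)
    finish = record
      { V       = V′
      ; V≥0     = V′≥0
      ; bounded = λ b cap → ≤-trans (bounded′ b cap) (+-monoʳ-≤ _ (Φ≤2S b cap))
      ; paid    = ≤-trans (≤-reflexive (∑-++ ten old newBins)) unfilled-paid }
      where open Spend false

    advance : ∃₂ λ old′ newest′ → Invariant (suc j) old′ newest′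
                × foldl place (old ++ newBins) all ≡ old′ ++ firstFit newest′
    -- The instance passes the old bins, then the newest class; what both reject forms the next
    -- class.
    advance with run old all
    ... | old₁ , rs , ρ with run newBins rs
    ... | bs′ , newest′ , σ = old₁ ++ bs′ , newest′ , next (all? filled? bs′) , state
      where
      state : foldl place (old ++ newBins) all ≡ (old₁ ++ bs′) ++ firstFit newest′
      state = begin
        foldl place (old ++ newBins) all       ≡⟨ foldl-run ρ newBins ⟩
        old₁ ++ foldl place newBins rs         ≡⟨ ≡.cong (λ bs → old₁ ++ foldl place bs rs) (++-identityʳ newBins) ⟨
        old₁ ++ foldl place (newBins ++ []) rs ≡⟨ ≡.cong (old₁ ++_) (foldl-run σ []) ⟩
        old₁ ++ (bs′ ++ firstFit newest′)      ≡⟨ ++-assoc old₁ bs′ _ ⟨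
        (old₁ ++ bs′) ++ firstFit newest′      ∎
        where open ≡.≡-Reasoning

      capacity′ : All Capacity bs′
      capacity′ = run-capacity σ newBins-capacity

      unique′ : Unique newest′
      unique′ = run-unique σ (run-unique ρ (Unique.allFin⁺ n))

      tens : ∑ ten (old₁ ++ bs′) ≈ ∑ ten old + ∑ ten newBins
      tens = ≈-trans (∑-++ ten old₁ bs′)
        (AbelianGroup.reflexive abelianGroup (≡.cong₂ _+_ (run-ten ρ) (run-ten σ)))

      -- The new `light` is the negation of `filled`, so `bounded′` already has the required gate
      -- and the excesses telescope.
      next : Dec (All Filled bs′) → Invariant (suc j) (old₁ ++ bs′) newest′
      next (yes full) = record
        { unique = unique′ ; light = false ; V = V′ ; V≥0 = V′≥0 ; bounded = bounded′ ; scraps = λ ()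
        ; paid = λ v v≥0 rate → linear
            (∑ ten (old₁ ++ bs′) ∷ ∑ v newest′ ∷ ∑ V′ all ∷ ∑ v all ∷ suc j · (30 · S)
              ∷ ∑ ten old + ∑ ten newBins ∷ ∑ ∑fill newBins ∷ ∑ ∑fill bs′ ∷ ∑ v rs ∷ [])
            (x₀ ⊕ x₁) (x₂ ⊕ x₃ ⊕ x₄) 0
            (⟨ x₀ ≲ x₅ ⟩ ≤-reflexive tens
              ⊞ ⟨ x₅ ⊕ x₆ ≲ x₂ ⊕ x₄ ⊕ x₇ ⟩ all-paid (run-grown σ (grown-refl newBins)) capacity′ (λ _ → full)
              ⊞ ⟨ x₇ ⊕ x₁ ≲ x₆ ⊕ x₈ ⟩ run-∑ (rate ≡.refl) σ
              ⊞ ⟨ x₈ ≲ x₃ ⟩ run-∑-rejected v≥0 ρ) ≡.refl }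
        where open Spend true
      next (no ¬full) = record
        { unique = unique′ ; light = true ; V = V′ ; V≥0 = V′≥0 ; bounded = bounded′ ; scraps = λ _ → few-scraps
        ; paid = λ v v≥0 _ → linear
            (∑ ten (old₁ ++ bs′) ∷ ∑ v newest′ ∷ ∑ V′ all ∷ ∑ v all ∷ suc j · (30 · S)
              ∷ ∑ ten old + ∑ ten newBins ∷ ∑ v rs ∷ [])
            (x₀ ⊕ x₁) (x₂ ⊕ x₃ ⊕ x₄) 0
            (⟨ x₀ ≲ x₅ ⟩ ≤-reflexive tens ⊞ ⟨ x₅ ≲ x₂ ⊕ x₄ ⟩ unfilled-paid
              ⊞ ⟨ x₁ ≲ x₆ ⟩ run-∑-rejected v≥0 σ ⊞ ⟨ x₆ ≲ x₃ ⟩ run-∑-rejected v≥0 ρ) ≡.refl }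
        where
        open Spend false
        few-scraps : ∑ (scrap ∘ sizeOf) newest′ ≤ 2 · S
        few-scraps with find (¬All⇒Any¬ filled? bs′ ¬full)
        ... | b , b∈bs′ , ¬filled with any? large? b
        ... | no none  = ⊥-elim (¬filled (λ some → ⊥-elim (none some)))
        ... | yes some with find some
        ... | x , x∈b , lx = unfit-scraps x∈b lx (λ full → ¬filled (λ _ → full)) unique′
          (All.map (λ unfit → All.lookup unfit b∈bs′) (run-unfit σ))

  main : ∀ k {j old newest} → Invariant j old newest →
         Outcome (k ℕ.+ suc j) (foldl place (old ++ firstFit newest) (copies k))
  main zero inv = finish inv
  main (suc k) {j} {old} {newest} inv with advance inv
  ... | old′ , newest′ , inv′ , eq = ≡.subst₂ Outcome (ℕ.+-suc k (suc j))
    (≡.sym (≡.trans (foldl-++ place (old ++ firstFit newest) all (copies k)) (≡.cong (λ bs → foldl place bs (copies k)) eq)))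
    (main k inv′)

  outcome : ∀ k → Outcome (suc k) (foldl place [] (copies (suc k)))
  outcome k = ≡.subst₂ Outcome (ℕ.+-comm k 1) (≡.sym (foldl-++ place [] all (copies k))) (main k initial)
    where
    initial : Invariant 0 [] all
    initial = record
      -- The first class counts as ordinary: there is no excess of an earlier class to take back.
      { unique = Unique.allFin⁺ n ; light = false ; V = λ _ → 0# ; V≥0 = λ _ → ≤-refl
      ; bounded = λ b _ → ≤-trans (≤-reflexive (∑-0 (All.universal (λ _ → ≈-refl) b))) (≤-reflexive (≈-sym (+-identityˡ 0#)))
      ; scraps = λ ()
      ; paid = λ u _ _ → linear (∑ u all ∷ ∑ (λ _ → 0#) all ∷ []) (∅ ⊕ x₀) (x₁ ⊕ x₀ ⊕ ∅) 0
          (⟨ ∅ ≲ x₁ ⟩ ∑-nonneg (λ _ → ≤-refl) all) ≡.refl }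

-- Comparison with the optimum

module Comparison {c ℓ₁ ℓ₂ : Level} (G : OrderedAbelianGroup c ℓ₁ ℓ₂)
            {n : ℕ} (D : Vector (OrderedAbelianGroup.Carrier G) n)
            (S : OrderedAbelianGroup.Carrier G) where

  open OrderedAbelianGroup G
  open LinearArithmetic G
  open Sums G
  open BinPacking G D S

  module _ (V : Item → Carrier) (V≥0 : ∀ i → 0# ≤ V i) where

    multiplicity-∷ : ∀ {is b bs} →
      ∑ (λ i → multiplicity i (b ∷ bs) · V i) is
        ≤ ∑ V (filter (λ i → _∈?_ _≟_ i b) is) + ∑ (λ i → multiplicity i bs · V i) is
    multiplicity-∷ {[]} = ≤-reflexive (≈-sym (+-identityˡ 0#))
    multiplicity-∷ {i ∷ is} {b} {bs} with _∈?_ _≟_ i b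
    ... | yes _ = ≤-trans (+-monoʳ-≤ _ (multiplicity-∷ {is} {b} {bs})) (≤-reflexive (interchange _ _ _ _))
    ... | no _  = ≤-trans (+-monoʳ-≤ _ (multiplicity-∷ {is} {b} {bs})) (≤-reflexive (x∙yz≈y∙xz _ _ _))

    -- Double counting: `b` contributes to the left the items occurring in it, each once, and their
    -- weight is at most `∑ V b`.
    ∑-multiplicity : ∀ bs → ∑ (λ i → multiplicity i bs · V i) (allFin n) ≤ ∑ (∑ V) bs
    ∑-multiplicity []       = ≤-reflexive (∑-0 (All.universal (λ _ → ≈-refl) (allFin n)))
    ∑-multiplicity (b ∷ bs) = ≤-trans (multiplicity-∷ {allFin n} {b} {bs}) (+-mono-≤
      (∑-⊆ V≥0 (Unique.filter⁺ _ (Unique.allFin⁺ n)) (λ i∈ → proj₂ (∈-filter⁻ (λ i → _∈?_ _≟_ i b) {xs = allFin n} i∈)))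
      (∑-multiplicity bs))

  -- A positive multiplicity puts the item into some bin within capacity. First-Fit relies on this
  -- when it opens a bin.
  item≤S : (∀ i → 0# ≤ D i) → ∀ {k bs} → IsPacking (suc k) bs → ∀ i → D i ≤ S
  item≤S 0≤D {bs = bs} packing i = covered bs (k-times i) withinCapacity
    where
    open IsPacking packing
    covered : ∀ {k} bs → multiplicity i bs ≡ suc k → All (λ b → load b ≤ S) bs → D i ≤ S
    covered (b ∷ bs) eq (cap ∷ caps) with _∈?_ _≟_ i b
    ... | yes i∈b = ≤-trans (∈⇒≤∑ 0≤D i∈b) cap
    ... | no _    = covered bs eq caps

  ·-cancelʳ-≤ : ¬ S ≤ 0# → ∀ m n → m · S ≤ n · S → m ℕ.≤ n
  ·-cancelʳ-≤ S≰0 zero    n       p = ℕ.z≤n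
  ·-cancelʳ-≤ S≰0 (suc m) (suc n) p = ℕ.s≤s (·-cancelʳ-≤ S≰0 m n (+-cancelˡ-≤ S p))
  ·-cancelʳ-≤ S≰0 (suc m) zero    p = ⊥-elim (S≰0 (linear (S ∷ m · S ∷ []) x₀ ∅ 0
    (⟨ x₀ ⊕ x₁ ≲ ∅ ⟩ p ⊞ ⟨ ∅ ≲ x₁ ⟩ 0≤mS m) ≡.refl))
    where
    0≤mS : ∀ m → 0# ≤ m · S
    0≤mS m = ≤-trans (≤-reflexive (≈-sym (·-zeroʳ m))) (·-monoʳ-≤ m (≰⇒≥ S≰0))

  -- Each item occurs in `k` bins of the packing, so `k` times the total of `V` is at most
  -- `15 · k + 2` times `S` per bin; hence the factor `suc k` on the left. Dividing by `10 · k`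
  -- gives the ratio and the additive 3k.
  FFk-bound : ¬ S ≤ 0# → (∀ i → 0# ≤ D i) → ∀ k {bs} → IsPacking (suc k) bs →
    suc k ℕ.* (FFk (suc k) ℕ.* 10)
      ℕ.≤ length bs ℕ.* (suc k ℕ.* 15 ℕ.+ 2) ℕ.+ suc k ℕ.* (suc k ℕ.* 30)
  FFk-bound S≰0 0≤D k-1 {bs} packing = ·-cancelʳ-≤ S≰0 _ _ (≤-trans (≤-reflexive collectˡ)
    (≤-trans scaled (≤-reflexive (≈-sym collectʳ))))
    where
    open Analysis G D S (≰⇒≥ S≰0) 0≤D (item≤S 0≤D packing) using (Outcome; outcome)
    open Outcome (outcome k-1)
    open IsPacking packing
    k FF m : ℕ
    k  = suc k-1
    FF = FFk k
    m  = length bs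
    bins : List Bin
    bins = foldl place [] (copies k)
    binCost : Carrier
    binCost = k · (15 · S) + 2 · S

    optimal : k · ∑ V (allFin n) ≤ m · binCost
    optimal = ≤-trans (≤-reflexive (≈-sym (∑-· k V (allFin n))))
      (≤-trans (∑-mono (λ i → ≤-reflexive (reflexive (≡.cong (_· V i) (≡.sym (k-times i))))) (allFin n))
        (≤-trans (∑-multiplicity V V≥0 bs)
          (≤-trans (∑-mono-All (All.map (λ {b} cap → bounded b cap) withinCapacity)) (≤-reflexive (∑-const binCost bs)))))
      where open AbelianGroup abelianGroup using (reflexive)

    scaled : k · (FF · (10 · S)) ≤ m · binCost + k · (k · (30 · S))
    scaled = ≤-trans
      (·-monoʳ-≤ k (≤-trans (≤-reflexive (≈-sym (∑-const (10 · S) bins))) paid))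
      (≤-trans (≤-reflexive (×-distrib-+ _ _ k)) (+-mono-≤ optimal ≤-refl))

    collectˡ : (k ℕ.* (FF ℕ.* 10)) · S ≈ k · (FF · (10 · S))
    collectˡ = ≈-trans (≈-sym (×-assocˡ S k (FF ℕ.* 10))) (×-congʳ k (≈-sym (×-assocˡ S FF 10)))

    collectʳ : (m ℕ.* (k ℕ.* 15 ℕ.+ 2) ℕ.+ k ℕ.* (k ℕ.* 30)) · S ≈ m · binCost + k · (k · (30 · S))
    collectʳ = ≈-trans (×-homo-+ S (m ℕ.* (k ℕ.* 15 ℕ.+ 2)) _) (+-cong
      (≈-trans (≈-sym (×-assocˡ S m (k ℕ.* 15 ℕ.+ 2))) (×-congʳ m
        (≈-trans (×-homo-+ S (k ℕ.* 15) 2) (+-cong (≈-sym (×-assocˡ S k 15)) ≈-refl))))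
      (≈-trans (≈-sym (×-assocˡ S k (k ℕ.* 30))) (×-congʳ k (≈-sym (×-assocˡ S k 30)))))

-- The bound in rational numbers

rational-bound : ∀ k F m → suc k ℕ.* (F ℕ.* 10) ℕ.≤ m ℕ.* (suc k ℕ.* 15 ℕ.+ 2) ℕ.+ suc k ℕ.* (suc k ℕ.* 30) →
  (+ F) ℚ./ 1 ℚ.≤ ((+ 3) ℚ./ 2 ℚ.+ ℚ._/_ (+ 1) (5 ℕ.* suc k) {{m*n≢0 5 (suc k)}}) ℚ.* ((+ m) ℚ./ 1)
                  ℚ.+ (+ (3 ℕ.* suc k)) ℚ./ 1
rational-bound k-1 F m p = ℚ.toℚᵘ-cancel-≤ (begin
  ℚ.toℚᵘ ((+ F) ℚ./ 1)                    ≃⟨ ℚ.toℚᵘ-fromℚᵘ (mkℚᵘ (+ F) 0) ⟩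
  mkℚᵘ (+ F) 0                            ≤⟨ *≤* crossMultiplied ⟩
  (a ℚᵘ.+ b) ℚᵘ.* o ℚᵘ.+ e                ≃⟨ ℚᵘ.≃-sym normalised ⟩
  ℚ.toℚᵘ ((A ℚ.+ B) ℚ.* O ℚ.+ E)          ∎)
  where
  open ℚᵘ.≤-Reasoning
  k : ℕ
  k = suc k-1
  -- Unnormalised fractions let numerators and denominators compute without gcds; `mkℚᵘ` takes the
  -- denominator minus one.
  a b o e : ℚᵘ.ℚᵘ
  a = mkℚᵘ (+ 3) 1
  b = mkℚᵘ (+ 1) (ℕ.pred (5 ℕ.* k))
  o = mkℚᵘ (+ m) 0
  e = mkℚᵘ (+ (3 ℕ.* k)) 0
  A B O E : ℚ.ℚ
  A = ℚ.fromℚᵘ a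
  B = ℚ.fromℚᵘ b
  O = ℚ.fromℚᵘ o
  E = ℚ.fromℚᵘ e
  normalised : ℚ.toℚᵘ ((A ℚ.+ B) ℚ.* O ℚ.+ E) ℚᵘ.≃ (a ℚᵘ.+ b) ℚᵘ.* o ℚᵘ.+ e
  normalised = ℚᵘ.≃-trans (ℚ.toℚᵘ-homo-+ ((A ℚ.+ B) ℚ.* O) E) (ℚᵘ.+-cong
    (ℚᵘ.≃-trans (ℚ.toℚᵘ-homo-* (A ℚ.+ B) O) (ℚᵘ.*-cong
      (ℚᵘ.≃-trans (ℚ.toℚᵘ-homo-+ A B) (ℚᵘ.+-cong (ℚ.toℚᵘ-fromℚᵘ a) (ℚ.toℚᵘ-fromℚᵘ b)))
      (ℚ.toℚᵘ-fromℚᵘ o)))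
    (ℚ.toℚᵘ-fromℚᵘ e))
  q : ℚᵘ.ℚᵘ
  q = (a ℚᵘ.+ b) ℚᵘ.* o ℚᵘ.+ e
  d : ℕ
  d = 2 ℕ.* (5 ℕ.* k) ℕ.* 1
  numerator : ∀ x y z → (+ 3 ℤ.* + x ℤ.+ + 2) ℤ.* + m ℤ.* + 1 ℤ.+ + y ℤ.* + z
                        ≡ + ((3 ℕ.* x ℕ.+ 2) ℕ.* m ℕ.* 1 ℕ.+ y ℕ.* z)
  numerator x y z
    rewrite ≡.sym (ℤ.pos-* 3 x) | ≡.sym (ℤ.pos-* (3 ℕ.* x ℕ.+ 2) m)
          | ≡.sym (ℤ.pos-* ((3 ℕ.* x ℕ.+ 2) ℕ.* m) 1) | ≡.sym (ℤ.pos-* y z) = ≡.refl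
  scaled : F ℕ.* (d ℕ.* 1) ℕ.≤ ((3 ℕ.* (5 ℕ.* k) ℕ.+ 2) ℕ.* m ℕ.* 1 ℕ.+ 3 ℕ.* k ℕ.* d) ℕ.* 1
  scaled = ≡.subst₂ ℕ._≤_ (left k F) (right k m) p
    where
    left : ∀ k F → k ℕ.* (F ℕ.* 10) ≡ F ℕ.* (2 ℕ.* (5 ℕ.* k) ℕ.* 1 ℕ.* 1)
    left = ℕ-Solver.solve-∀
    right : ∀ k m → m ℕ.* (k ℕ.* 15 ℕ.+ 2) ℕ.+ k ℕ.* (k ℕ.* 30)
            ≡ ((3 ℕ.* (5 ℕ.* k) ℕ.+ 2) ℕ.* m ℕ.* 1 ℕ.+ 3 ℕ.* k ℕ.* (2 ℕ.* (5 ℕ.* k) ℕ.* 1)) ℕ.* 1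
    right = ℕ-Solver.solve-∀
  crossMultiplied : + F ℤ.* ℚᵘ.↧ q ℤ.≤ ℚᵘ.↥ q ℤ.* + 1
  crossMultiplied = ℤ.≤-trans (ℤ.≤-reflexive (≡.sym (ℤ.pos-* F (d ℕ.* 1))))
    (ℤ.≤-trans (ℤ.+≤+ scaled) (ℤ.≤-reflexive (≡.trans (ℤ.pos-* ((3 ℕ.* (5 ℕ.* k) ℕ.+ 2) ℕ.* m ℕ.* 1 ℕ.+ 3 ℕ.* k ℕ.* d) 1)
      (≡.cong (ℤ._* + 1) (≡.sym (numerator (5 ℕ.* k) (3 ℕ.* k) d))))))

open import Data.Rational using (_/_; _+_; _*_; _≤_)

theorem2 : ∀ {c ℓ₁ ℓ₂} (G : OrderedAbelianGroup c ℓ₁ ℓ₂) →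
    let module G = OrderedAbelianGroup G in
    ∀ (n : ℕ) (D : Vector G.Carrier n) (S : G.Carrier) →
    let open BinPacking G D S in
    G.0# G.< S → (∀ i → G.0# G.< D i) →
    ∀ (k : ℕ) .{{_ : NonZero k}} (opt : ℕ) → IsOPT k opt →
    (+ FFk k) / 1 ≤
    ((+ 3) / 2 + _/_ (+ 1) (5 ℕ.* k) {{m*n≢0 5 k}}) * ((+ opt) / 1) + (+ (3 ℕ.* k)) / 1
theorem2 G n D S (0≤S , 0≉S) 0<D (suc k) opt ((bs , packing , ≡.refl) , _) =
  rational-bound k (BinPacking.FFk G D S (suc k)) opt
    (Comparison.FFk-bound G D S (λ S≤0 → 0≉S (antisym 0≤S S≤0)) (λ i → proj₁ (0<D i)) k packing)
  where open IsDecTotalOrder (OrderedAbelianGroup.isDecTotalOrder G) using (antisym)
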